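{- Let $S$ be a finite sample space with a probability distribution $D$. Let $X_1,\ldots,X_N$ be random variables over $S$ that take values in $\{0,1\}$. Let $N'\le N$ and let $\{\lambda_i\}_{i\in[N]}$, $\{p_i\}_{i\in[N]}$ be real numbers such that $$0<\lambda_i<p_i\le \mathbb{E}_{s\sim D}[X_i]\quad\text{for all } i\in[N'],\qquad 1>\lambda_j>p_j\ge \mathbb{E}_{s\sim D}[X_j]\quad\text{for all } j\in(N',N].$$ Let $m$ be a positive integer such that $$P_0:=\sum_{i=1}^N e^{ -D(\lambda_i\|p_i)\cdot m}\le 1.$$ Then there exists a multiset $S'=\{s_1,s_2,\ldots,s_m\}\subseteq S$ such that for all $i\in[N']$ and $j\in(N',N]$ $$\mathbb{E}_{s\sim U_{S'}}[X_i(s)]\ge\lambda_i,\qquad \mathbb{E}_{s\sim U_{S'}}[X_j(s)]\le\lambda_j.$$ In particular, the result follows for $$m\ge \max_{i\in[N]}\frac{\ln N}{D(\lambda_i\|p_i)}=\max_{i\in[N]}\frac{\log_{q_i}N}{1-H_{q_i}(\lambda_i)},\qquad q_i=\frac{1}{1-p_i}.$$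
   Context: For integers $n\le m$: $[n]=\{1,\ldots,n\}$ and $(n,m]=\{n+1,\ldots,m\}$. For a finite multiset $S'$, $U_{S'}$ is the uniform distribution over $S'$ (elements counted with multiplicity). The Kullback-Leibler divergence between Bernoulli variables with parameters $\lambda,\eta\in(0,1)$ is $D(\lambda\|\eta)=\lambda\ln\frac{\lambda}{\eta}+(1-\lambda)\ln\frac{1-\lambda}{1-\eta}$. The $q$-ary entropy function, for real $q>1$, is $H_q(p)=p\log_q\frac{q-1}{p}+(1-p)\log_q\frac{1}{1-p}$. All $p_i$ lie in $(0,1)$, so that $D(\lambda_i\|p_i)$ and $q_i$ are defined. -}

module Defs where

open import Algebra.Bundles using (module CommutativeRing)
import Algebra.Properties.CommutativeSemiring.Exp as CommutativeExp
import Algebra.Properties.Semiring.Exp as Exp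
open import Data.Fin.Base using (Fin; zero; suc; toℕ)
open import Data.Integer.Base as ℤ using (ℤ)
import Data.Integer.Properties as ℤ
open import Data.Nat.Base as ℕ using (ℕ; zero; suc)
import Data.Nat.Properties as ℕ
open import Data.Product.Base using (Σ; ∃; _×_; _,_; proj₁; proj₂)
open import Data.Rational.Base as ℚ using (ℚ; 0ℚ; 1ℚ; ½; mkℚ; ∣_∣)
import Data.Rational.Properties as ℚ
open import Data.Rational.Solver using (module +-*-Solver)
import Data.Rational.Unnormalised.Base as ℚᵘ
import Data.Rational.Unnormalised.Properties as ℚᵘ
open import Data.Sum.Base using (_⊎_; inj₁; inj₂)
open import Data.Vec.Functional using (Vector; foldr)
open import Function.Bundles using (_↔_; module Inverse)
import Level
open import Relation.Binary.PropositionalEquality using (_≡_; refl; sym; trans; cong; cong₂; subst; subst₂)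
open import Relation.Nullary using (¬_; yes; no; contradiction)

module Rational where
  open import Data.Rational.Base using (_+_; _*_; _-_; -_; _≤_; _<_; *≤*; *<*; nonNegative; positive; 1/_; _⊔_; _⊓_)
  open CommutativeRing ℚ.+-*-commutativeRing using (semiring; commutativeSemiring)
  open Exp semiring public using (_^_)
  open Exp semiring using (^-homo-*; ^-assocʳ)
  open CommutativeExp commutativeSemiring using (^-distrib-*)
  open +-*-Solver

  fromℕ : ℕ → ℚ
  fromℕ zero    = 0ℚ
  fromℕ (suc n) = 1ℚ + fromℕ n

  infix 9 2^_ ½^_

  2^_ : ℕ → ℕ
  2^ k = 2 ℕ.^ k

  ½^_ : ℕ → ℚ
  ½^ k = ½ ^ k

  2ℚ 4ℚ ⅓ : ℚ
  2ℚ = 1ℚ + 1ℚ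
  4ℚ = 2ℚ + 2ℚ
  ⅓ = ℤ.+ 1 ℚ./ 3

  0<1 : 0ℚ < 1ℚ
  0<1 = ℚ.positive⁻¹ 1ℚ

  0<½ : 0ℚ < ½
  0<½ = ℚ.positive⁻¹ ½

  0≤1 : 0ℚ ≤ 1ℚ
  0≤1 = ℚ.<⇒≤ 0<1

  0≤½ : 0ℚ ≤ ½
  0≤½ = ℚ.<⇒≤ 0<½

  ≤-by : ∀ {a b} c → 0ℚ ≤ c → a + c ≡ b → a ≤ b
  ≤-by {a} c 0≤c refl = subst (_≤ a + c) (ℚ.+-identityʳ a) (ℚ.+-monoʳ-≤ a 0≤c)

  <-by : ∀ {a b} c → 0ℚ < c → a + c ≡ b → a < b
  <-by {a} c 0<c refl = subst (_< a + c) (ℚ.+-identityʳ a) (ℚ.+-monoʳ-< a 0<c)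

  diff≥0 : ∀ {a b} → a ≤ b → 0ℚ ≤ b - a
  diff≥0 {a} {b} a≤b = subst (_≤ b - a) (ℚ.+-inverseʳ a) (ℚ.+-monoˡ-≤ (- a) a≤b)

  diff>0 : ∀ {a b} → a < b → 0ℚ < b - a
  diff>0 {a} {b} a<b = subst (_< b - a) (ℚ.+-inverseʳ a) (ℚ.+-monoˡ-< (- a) a<b)

  +-≥0 : ∀ {a b} → 0ℚ ≤ a → 0ℚ ≤ b → 0ℚ ≤ a + b
  +-≥0 {a} {b} p q = ℚ.≤-trans p (≤-by b q refl)

  *-≥0 : ∀ {a b} → 0ℚ ≤ a → 0ℚ ≤ b → 0ℚ ≤ a * b
  *-≥0 {a} {b} p q = subst (_≤ a * b) (ℚ.*-zeroʳ a) (ℚ.*-monoˡ-≤-nonNeg a {{nonNegative p}} q)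

  +->0 : ∀ {a b} → 0ℚ < a → 0ℚ ≤ b → 0ℚ < a + b
  +->0 {a} {b} p q = ℚ.<-≤-trans p (≤-by b q refl)

  *->0 : ∀ {a b} → 0ℚ < a → 0ℚ < b → 0ℚ < a * b
  *->0 {a} {b} p q = subst (_< a * b) (ℚ.*-zeroʳ a) (ℚ.*-monoʳ-<-pos a {{positive p}} q)

  *-monoˡ : ∀ {a b} c → 0ℚ ≤ c → a ≤ b → c * a ≤ c * b
  *-monoˡ c 0≤c = ℚ.*-monoˡ-≤-nonNeg c {{nonNegative 0≤c}}

  *-monoʳ : ∀ {a b} c → 0ℚ ≤ c → a ≤ b → a * c ≤ b * c
  *-monoʳ c 0≤c = ℚ.*-monoʳ-≤-nonNeg c {{nonNegative 0≤c}}

  *-mono : ∀ {a b c d} → 0ℚ ≤ a → 0ℚ ≤ d → a ≤ b → c ≤ d → a * c ≤ b * d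
  *-mono {a} {b} {c} {d} 0≤a 0≤d a≤b c≤d = ℚ.≤-trans (*-monoˡ a 0≤a c≤d) (*-monoʳ d 0≤d a≤b)

  half>0 : ∀ {ε} → 0ℚ < ε → 0ℚ < ½ * ε
  half>0 = *->0 0<½

  halves : ∀ ε → ½ * ε + ½ * ε ≡ ε
  halves = solve 1 (λ ε → con ½ :* ε :+ con ½ :* ε := ε) refl

  0≤∣_∣ : ∀ a → 0ℚ ≤ ∣ a ∣
  0≤∣_∣ = ℚ.0≤∣p∣

  a≤∣a∣ : ∀ a → a ≤ ∣ a ∣
  a≤∣a∣ a with ℚ.≤-total 0ℚ a
  ... | inj₁ 0≤a = ℚ.≤-reflexive (sym (ℚ.0≤p⇒∣p∣≡p 0≤a))
  ... | inj₂ a≤0 = ℚ.≤-trans a≤0 (ℚ.0≤∣p∣ a)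

  -a≤∣a∣ : ∀ a → - a ≤ ∣ a ∣
  -a≤∣a∣ a = subst (- a ≤_) (ℚ.∣-p∣≡∣p∣ a) (a≤∣a∣ (- a))

  ∣∣≤ : ∀ {a c} → a ≤ c → - a ≤ c → ∣ a ∣ ≤ c
  ∣∣≤ {a} {c} p q with ℚ.∣p∣≡p∨∣p∣≡-p a
  ... | inj₁ e = subst (_≤ c) (sym e) p
  ... | inj₂ e = subst (_≤ c) (sym e) q

  ∣∣-comm : ∀ a b → ∣ a - b ∣ ≡ ∣ b - a ∣
  ∣∣-comm a b = trans (sym (ℚ.∣-p∣≡∣p∣ (a - b)))
    (cong ∣_∣ (solve 2 (λ a b → :- (a :- b) := b :- a) refl a b))

  ∣∣-triangle : ∀ a b c → ∣ a - c ∣ ≤ ∣ a - b ∣ + ∣ b - c ∣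
  ∣∣-triangle a b c = subst (λ t → ∣ t ∣ ≤ ∣ a - b ∣ + ∣ b - c ∣)
    (solve 3 (λ a b c → (a :- b) :+ (b :- c) := a :- c) refl a b c)
    (ℚ.∣p+q∣≤∣p∣+∣q∣ (a - b) (b - c))

  near⇒≤ : ∀ {a b ε} → ∣ a - b ∣ ≤ ε → a ≤ b + ε
  near⇒≤ {a} {b} {ε} p = ≤-by (ε - (a - b)) (diff≥0 (ℚ.≤-trans (a≤∣a∣ _) p))
    (solve 3 (λ a b ε → a :+ (ε :- (a :- b)) := b :+ ε) refl a b ε)

  near⇒≥ : ∀ {a b ε} → ∣ a - b ∣ ≤ ε → b ≤ a + ε
  near⇒≥ {a} {b} {ε} p = near⇒≤ (subst (_≤ ε) (∣∣-comm a b) p)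

  ≤⇒near : ∀ {a b ε} → a ≤ b + ε → b ≤ a + ε → ∣ a - b ∣ ≤ ε
  ≤⇒near {a} {b} {ε} p q = ∣∣≤
    (≤-by _ (diff≥0 p) (solve 3 (λ a b ε → (a :- b) :+ (b :+ ε :- a) := ε) refl a b ε))
    (≤-by _ (diff≥0 q) (solve 3 (λ a b ε → :- (a :- b) :+ (a :+ ε :- b) := ε) refl a b ε))

  inverse : ℚ → ℚ
  inverse q with q ℚ.≟ 0ℚ
  ... | yes _  = 0ℚ
  ... | no q≢0 = (1/ q) {{ℚ.≢-nonZero q≢0}}

  inverse-*ˡ : ∀ {q} → 0ℚ < q → inverse q * q ≡ 1ℚ
  inverse-*ˡ {q} 0<q with q ℚ.≟ 0ℚ
  ... | yes q≡0 = contradiction (sym q≡0) (ℚ.<⇒≢ 0<q)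
  ... | no q≢0  = ℚ.*-inverseˡ q {{ℚ.≢-nonZero q≢0}}

  cancel-≤ : ∀ {a b} c → 0ℚ < c → a * c ≤ b * c → a ≤ b
  cancel-≤ c 0<c = ℚ.*-cancelʳ-≤-pos c {{positive 0<c}}

  inverse>0 : ∀ {q} → 0ℚ < q → 0ℚ < inverse q
  inverse>0 {q} 0<q = ℚ.*-cancelʳ-<-nonNeg q {{nonNegative (ℚ.<⇒≤ 0<q)}}
    (subst₂ _<_ (sym (ℚ.*-zeroˡ q)) (sym (inverse-*ˡ 0<q)) 0<1)

  inverse-anti : ∀ {a b} → 0ℚ < a → a ≤ b → inverse b ≤ inverse a
  inverse-anti {a} {b} 0<a a≤b = cancel-≤ (a * b) (*->0 0<a 0<b)
    (subst₂ _≤_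
      (trans (sym (ℚ.*-identityʳ a)) (trans (cong (a *_) (sym (inverse-*ˡ 0<b)))
        (solve 3 (λ a b i → a :* (i :* b) := i :* (a :* b)) refl a b (inverse b))))
      (trans (sym (ℚ.*-identityˡ b)) (trans (cong (_* b) (sym (inverse-*ˡ 0<a)))
        (solve 3 (λ a b i → (i :* a) :* b := i :* (a :* b)) refl a b (inverse a))))
      a≤b)
    where 0<b = ℚ.<-≤-trans 0<a a≤b

  fromℕ-≥0 : ∀ n → 0ℚ ≤ fromℕ n
  fromℕ-≥0 zero    = ℚ.≤-refl
  fromℕ-≥0 (suc n) = +-≥0 0≤1 (fromℕ-≥0 n)

  fromℕ-mono : ∀ {m n} → m ℕ.≤ n → fromℕ m ≤ fromℕ n
  fromℕ-mono {n = n} ℕ.z≤n = fromℕ-≥0 n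
  fromℕ-mono (ℕ.s≤s p) = ℚ.+-monoʳ-≤ 1ℚ (fromℕ-mono p)

  fromℕ-+ : ∀ m n → fromℕ (m ℕ.+ n) ≡ fromℕ m + fromℕ n
  fromℕ-+ zero    n = sym (ℚ.+-identityˡ (fromℕ n))
  fromℕ-+ (suc m) n = trans (cong (1ℚ +_) (fromℕ-+ m n)) (sym (ℚ.+-assoc 1ℚ (fromℕ m) (fromℕ n)))

  fromℕ≃ : ∀ n → ℚ.toℚᵘ (fromℕ n) ℚᵘ.≃ ℚᵘ.mkℚᵘ (ℤ.+ n) 0
  fromℕ≃ zero    = ℚᵘ.≃-refl
  fromℕ≃ (suc n) = ℚᵘ.≃-trans (ℚ.toℚᵘ-homo-+ 1ℚ (fromℕ n))
    (ℚᵘ.≃-trans (ℚᵘ.+-congʳ ℚᵘ.1ℚᵘ (fromℕ≃ n)) (ℚᵘ.*≡* eq))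
    where
    eq : ((ℤ.+ 1) ℤ.* (ℤ.+ 1) ℤ.+ (ℤ.+ n) ℤ.* (ℤ.+ 1)) ℤ.* (ℤ.+ 1) ≡ (ℤ.+ suc n) ℤ.* (ℤ.+ 1)
    eq = cong (ℤ._* (ℤ.+ 1)) (cong (λ i → (ℤ.+ 1) ℤ.+ i) (ℤ.*-identityʳ (ℤ.+ n)))

  opaque
    archimedean : ∀ q → ∃ λ n → q ≤ fromℕ n
    archimedean q@(mkℚ (ℤ.+ n) d _) = n , ℚ.toℚᵘ-cancel-≤
      (ℚᵘ.≤-trans {j = ℚᵘ.mkℚᵘ (ℤ.+ n) 0}
        (ℚᵘ.*≤* (subst₂ ℤ._≤_ (ℤ.pos-* n 1) (ℤ.pos-* n (suc d))
          (ℤ.+≤+ (ℕ.*-monoʳ-≤ n (ℕ.s≤s ℕ.z≤n)))))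
        (ℚᵘ.≤-reflexive (ℚᵘ.≃-sym (fromℕ≃ n))))
    archimedean q@(mkℚ ℤ.-[1+ n ] d _) = 0 , *≤* ℤ.-≤+

    archimedean′ : ∀ q {ε} → 0ℚ < ε → ∃ λ n → q ≤ ε * fromℕ n
    archimedean′ q {ε} 0<ε with archimedean (q * inverse ε)
    ... | n , p = n , subst (_≤ ε * fromℕ n)
      (trans (solve 3 (λ q ε i → ε :* (q :* i) := q :* (i :* ε)) refl q ε (inverse ε))
        (trans (cong (q *_) (inverse-*ˡ 0<ε)) (ℚ.*-identityʳ q)))
      (*-monoˡ ε (ℚ.<⇒≤ 0<ε) p)

  ^-≥0 : ∀ {a} n → 0ℚ ≤ a → 0ℚ ≤ a ^ n
  ^-≥0 zero    p = 0≤1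
  ^-≥0 (suc n) p = *-≥0 p (^-≥0 n p)

  ^->0 : ∀ {a} n → 0ℚ < a → 0ℚ < a ^ n
  ^->0 zero    p = 0<1
  ^->0 (suc n) p = *->0 p (^->0 n p)

  ^-mono : ∀ {a b} n → 0ℚ ≤ a → a ≤ b → a ^ n ≤ b ^ n
  ^-mono zero    p q = ℚ.≤-refl
  ^-mono (suc n) p q = *-mono p (^-≥0 n (ℚ.≤-trans p q)) q (^-mono n p q)

  1^ : ∀ n → 1ℚ ^ n ≡ 1ℚ
  1^ zero    = refl
  1^ (suc n) = trans (ℚ.*-identityˡ (1ℚ ^ n)) (1^ n)

  bernoulli : ∀ n {h} → 0ℚ ≤ 1ℚ + h → 1ℚ + fromℕ n * h ≤ (1ℚ + h) ^ n
  bernoulli zero    {h} p = ℚ.≤-reflexive (solve 1 (λ h → con 1ℚ :+ con 0ℚ :* h := con 1ℚ) refl h)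
  bernoulli (suc n) {h} p = ℚ.≤-trans
    (≤-by (fromℕ n * (h * h)) (*-≥0 (fromℕ-≥0 n) (sq h))
      (solve 2 (λ n h → con 1ℚ :+ (con 1ℚ :+ n) :* h :+ n :* (h :* h)
                        := (con 1ℚ :+ h) :* (con 1ℚ :+ n :* h)) refl (fromℕ n) h))
    (*-monoˡ (1ℚ + h) p (bernoulli n p))
    where
    sq : ∀ h → 0ℚ ≤ h * h
    sq h with ℚ.≤-total 0ℚ h
    ... | inj₁ 0≤h = *-≥0 0≤h 0≤h
    ... | inj₂ h≤0 = subst (0ℚ ≤_) (solve 1 (λ h → (:- h) :* (:- h) := h :* h) refl h)
                       (*-≥0 (ℚ.neg-antimono-≤ h≤0) (ℚ.neg-antimono-≤ h≤0))

  open ℚ.≤-Reasoning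

  geometric-bound : ∀ {r h} → 0ℚ ≤ r → 0ℚ < h → r * (1ℚ + h) ≤ 1ℚ → ∀ n → r ^ n * (1ℚ + fromℕ n * h) ≤ 1ℚ
  geometric-bound {r} {h} 0≤r 0<h r1h≤1 n = begin
        r ^ n * (1ℚ + fromℕ n * h) ≤⟨ *-monoˡ (r ^ n) (^-≥0 n 0≤r) (bernoulli n 0≤1h) ⟩
        r ^ n * (1ℚ + h) ^ n       ≡⟨ ^-distrib-* r (1ℚ + h) n ⟨
        (r * (1ℚ + h)) ^ n         ≤⟨ ^-mono n (*-≥0 0≤r 0≤1h) r1h≤1 ⟩
        1ℚ ^ n                     ≡⟨ 1^ n ⟩
        1ℚ                         ∎
      where
      0≤1h : 0ℚ ≤ 1ℚ + h
      0≤1h = ℚ.<⇒≤ (+->0 0<1 (ℚ.<⇒≤ 0<h))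

  geometric : ∀ r h → 0ℚ ≤ r → 0ℚ < h → r * (1ℚ + h) ≤ 1ℚ →
                ∀ K {ε} → 0ℚ ≤ K → 0ℚ < ε → ∃ λ N → ∀ n → N ℕ.≤ n → K * r ^ n ≤ ε
  geometric r h 0≤r 0<h r1h≤1 K {ε} 0≤K 0<ε = N , bound
      where
      0≤εh : 0ℚ ≤ ε * h
      0≤εh = ℚ.<⇒≤ (*->0 0<ε 0<h)
      N : ℕ
      N = proj₁ (archimedean′ K (*->0 0<ε 0<h))
      K≤ : K ≤ ε * h * fromℕ N
      K≤ = proj₂ (archimedean′ K (*->0 0<ε 0<h))
      s1 : ∀ n → N ℕ.≤ n → K ≤ ε * h * fromℕ n
      s1 n N≤n = ℚ.≤-trans K≤ (*-monoˡ (ε * h) 0≤εh (fromℕ-mono N≤n))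
      s2 : ∀ n → ε * h * fromℕ n * r ^ n ≤ ε * (r ^ n * (1ℚ + fromℕ n * h))
      s2 n = ≤-by (ε * r ^ n) (*-≥0 (ℚ.<⇒≤ 0<ε) (^-≥0 n 0≤r))
                                         (solve 4 (λ ε h n t → ε :* h :* n :* t :+ ε :* t := ε :* (t :* (con 1ℚ :+ n :* h))) refl ε h (fromℕ n) (r ^ n))
      bound : ∀ n → N ℕ.≤ n → K * r ^ n ≤ ε
      bound n N≤n = begin
        K * r ^ n                     ≤⟨ *-monoʳ (r ^ n) (^-≥0 n 0≤r) (s1 n N≤n) ⟩
        ε * h * fromℕ n * r ^ n       ≤⟨ s2 n ⟩
        ε * (r ^ n * (1ℚ + fromℕ n * h)) ≤⟨ *-monoˡ ε (ℚ.<⇒≤ 0<ε) (geometric-bound 0≤r 0<h r1h≤1 n) ⟩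
        ε * 1ℚ                        ≡⟨ ℚ.*-identityʳ ε ⟩
        ε                             ∎

  ½^-small : ∀ K {ε} → 0ℚ ≤ K → 0ℚ < ε → ∃ λ N → ∀ n → N ℕ.≤ n → K * ½^ n ≤ ε
  ½^-small = geometric ½ 1ℚ 0≤½ 0<1 ℚ.≤-refl

  ⅔^-small : ∀ K {ε} → 0ℚ ≤ K → 0ℚ < ε → ∃ λ N → ∀ n → N ℕ.≤ n → K * (⅓ + ⅓) ^ n ≤ ε
  ⅔^-small = geometric (⅓ + ⅓) ½ (ℚ.nonNegative⁻¹ (⅓ + ⅓)) 0<½ ℚ.≤-refl

  ^-diff : ∀ n {a b M} → 1ℚ ≤ M → ∣ a ∣ ≤ M → ∣ b ∣ ≤ M →
           ∣ a ^ n - b ^ n ∣ ≤ fromℕ n * (M ^ n * ∣ a - b ∣)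
  ^-diff zero    {a} {b} {M} 1≤M p q = ℚ.≤-reflexive (sym (ℚ.*-zeroˡ (1ℚ * ∣ a - b ∣)))
  ^-diff (suc n) {a} {b} {M} 1≤M p q = begin
    ∣ a * a ^ n - b * b ^ n ∣
      ≡⟨ cong ∣_∣ (solve 4 (λ a b s t → a :* s :- b :* t := a :* (s :- t) :+ (a :- b) :* t) refl a b (a ^ n) (b ^ n)) ⟩
    ∣ a * (a ^ n - b ^ n) + (a - b) * b ^ n ∣
      ≤⟨ ℚ.∣p+q∣≤∣p∣+∣q∣ (a * (a ^ n - b ^ n)) ((a - b) * b ^ n) ⟩
    ∣ a * (a ^ n - b ^ n) ∣ + ∣ (a - b) * b ^ n ∣
      ≡⟨ cong₂ _+_ (ℚ.∣p*q∣≡∣p∣*∣q∣ a (a ^ n - b ^ n)) (ℚ.∣p*q∣≡∣p∣*∣q∣ (a - b) (b ^ n)) ⟩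
    ∣ a ∣ * ∣ a ^ n - b ^ n ∣ + d * ∣ b ^ n ∣
      ≤⟨ ℚ.+-mono-≤ (*-mono (0≤∣ a ∣) (*-≥0 (fromℕ-≥0 n) (*-≥0 0≤Mⁿ (0≤∣ a - b ∣))) p (^-diff n 1≤M p q))
                    (*-monoˡ d (0≤∣ a - b ∣) (∣^∣ n q)) ⟩
    M * (fromℕ n * (M ^ n * d)) + d * M ^ n
      ≤⟨ ≤-by ((M - 1ℚ) * (M ^ n * d)) (*-≥0 (diff≥0 1≤M) (*-≥0 0≤Mⁿ (0≤∣ a - b ∣)))
           (solve 4 (λ n M t d → M :* (n :* (t :* d)) :+ d :* t :+ (M :- con 1ℚ) :* (t :* d)
                               := (con 1ℚ :+ n) :* (M :* t :* d)) refl (fromℕ n) M (M ^ n) d) ⟩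
    (1ℚ + fromℕ n) * (M * M ^ n * d) ∎
    where
    d = ∣ a - b ∣
    0≤M : 0ℚ ≤ M
    0≤M = ℚ.≤-trans 0≤1 1≤M
    0≤Mⁿ : 0ℚ ≤ M ^ n
    0≤Mⁿ = ^-≥0 n 0≤M
    ∣^∣ : ∀ n {b} → ∣ b ∣ ≤ M → ∣ b ^ n ∣ ≤ M ^ n
    ∣^∣ zero    q = ℚ.≤-refl
    ∣^∣ (suc n) {b} q = subst (_≤ M * M ^ n) (sym (ℚ.∣p*q∣≡∣p∣*∣q∣ b (b ^ n)))
                          (*-mono (0≤∣ b ∣) (^-≥0 n 0≤M) q (∣^∣ n q))

  approx : ℕ → ℚ → ℚ
  approx k q = (1ℚ + q * ½^ k) ^ 2^ k

  ½^≥0 : ∀ k → 0ℚ ≤ ½^ k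
  ½^≥0 k = ^-≥0 k 0≤½

  ½^≤1 : ∀ k → ½^ k ≤ 1ℚ
  ½^≤1 zero    = ℚ.≤-refl
  ½^≤1 (suc k) = ℚ.≤-trans (*-mono 0≤½ 0≤1 (≤-by ½ 0≤½ refl) (½^≤1 k)) ℚ.≤-refl

  2^-½^ : ∀ k → fromℕ (2^ k) * ½^ k ≡ 1ℚ
  2^-½^ zero    = refl
  2^-½^ (suc k) = let n = 2^ k in begin-equality
    fromℕ (n ℕ.+ (n ℕ.+ 0)) * (½ * ½^ k)
      ≡⟨ cong (λ m → fromℕ (n ℕ.+ m) * (½ * ½^ k)) (ℕ.+-identityʳ n) ⟩
    fromℕ (n ℕ.+ n) * (½ * ½^ k)
      ≡⟨ cong (_* (½ * ½^ k)) (fromℕ-+ n n) ⟩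
    (fromℕ n + fromℕ n) * (½ * ½^ k)
      ≡⟨ solve 2 (λ t u → (t :+ t) :* (con ½ :* u) := t :* u) refl (fromℕ n) (½^ k) ⟩
    fromℕ n * ½^ k
      ≡⟨ 2^-½^ k ⟩
    1ℚ ∎

  ^-double : ∀ a k → a ^ 2^ (suc k) ≡ (a * a) ^ 2^ k
  ^-double a k = let n = 2^ k in begin-equality
    a ^ (n ℕ.+ (n ℕ.+ 0)) ≡⟨ cong (λ m → a ^ (n ℕ.+ m)) (ℕ.+-identityʳ n) ⟩
    a ^ (n ℕ.+ n)         ≡⟨ ^-homo-* a n n ⟩
    a ^ n * a ^ n         ≡⟨ ^-distrib-* a a n ⟨
    (a * a) ^ n           ∎

  approx-1≤4 : ∀ k → (1ℚ + ½^ k) ^ 2^ k ≤ 4ℚ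
  approx-1≤4 k = begin
    X                     ≡⟨ solve 1 (λ X → X := X :* (con ½ :* con ½) :* con 4ℚ) refl X ⟩
    X * (½ * ½) * 4ℚ      ≤⟨ *-monoʳ 4ℚ (ℚ.nonNegative⁻¹ 4ℚ) (ℚ.≤-trans (*-monoˡ X 0≤X (*-mono 0≤½ (ℚ.≤-trans 0≤½ ½≤V) ½≤V ½≤V)) XVV≤1) ⟩
    1ℚ * 4ℚ               ≡⟨ ℚ.*-identityˡ 4ℚ ⟩
    4ℚ                    ∎
    where
    n = 2^ k
    u v X V : ℚ
    u = ½^ k
    v = 1ℚ + - (½ * u)
    X = (1ℚ + u) ^ n
    V = v ^ n
    0≤u : 0ℚ ≤ u
    0≤u = ½^≥0 k
    0≤1-u : 0ℚ ≤ 1ℚ - u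
    0≤1-u = diff≥0 (½^≤1 k)
    0≤v : 0ℚ ≤ v
    0≤v = ℚ.≤-trans 0≤1-u (≤-by (½ * u) (*-≥0 0≤½ 0≤u)
      (solve 1 (λ u → con 1ℚ :- u :+ con ½ :* u := con 1ℚ :+ :- (con ½ :* u)) refl u))
    0≤1+u : 0ℚ ≤ 1ℚ + u
    0≤1+u = +-≥0 0≤1 0≤u
    0≤X : 0ℚ ≤ X
    0≤X = ^-≥0 n 0≤1+u
    ½≤V : ½ ≤ V
    ½≤V = begin
      ½                                 ≡⟨⟩
      1ℚ + - (½ * 1ℚ)                   ≡⟨ cong (λ t → 1ℚ + - (½ * t)) (2^-½^ k) ⟨
      1ℚ + - (½ * (fromℕ n * u))        ≡⟨ solve 2 (λ n u → con 1ℚ :+ :- (con ½ :* (n :* u)) := con 1ℚ :+ n :* :- (con ½ :* u)) refl (fromℕ n) u ⟩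
      1ℚ + fromℕ n * - (½ * u)          ≤⟨ bernoulli n 0≤v ⟩
      V                                 ∎
    base : (1ℚ + u) * (v * v) ≤ 1ℚ
    base = ≤-by (½ * ½ * (u * u) * (1ℚ - u + 2ℚ))
      (*-≥0 (*-≥0 (*-≥0 0≤½ 0≤½) (*-≥0 0≤u 0≤u)) (+-≥0 0≤1-u (ℚ.nonNegative⁻¹ 2ℚ)))
      (solve 1 (λ u → let v = con 1ℚ :+ :- (con ½ :* u) in
        (con 1ℚ :+ u) :* (v :* v) :+ con ½ :* con ½ :* (u :* u) :* (con 1ℚ :- u :+ con 2ℚ) := con 1ℚ) refl u)
    XVV≤1 : X * (V * V) ≤ 1ℚ
    XVV≤1 = begin
      X * (V * V)                ≡⟨ cong (X *_) (^-distrib-* v v n) ⟨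
      X * (v * v) ^ n            ≡⟨ ^-distrib-* (1ℚ + u) (v * v) n ⟨
      ((1ℚ + u) * (v * v)) ^ n   ≤⟨ ^-mono n (*-≥0 0≤1+u (*-≥0 0≤v 0≤v)) base ⟩
      1ℚ ^ n                     ≡⟨ 1^ n ⟩
      1ℚ                         ∎

  1≤1+ : ∀ {a} → 0ℚ ≤ a → 1ℚ ≤ 1ℚ + a
  1≤1+ {a} p = ≤-by a p refl

  approx≤4^ : ∀ B k → approx k (fromℕ B) ≤ 4ℚ ^ B
  approx≤4^ B k = begin
    (1ℚ + fromℕ B * u) ^ n   ≤⟨ ^-mono n (+-≥0 0≤1 (*-≥0 (fromℕ-≥0 B) 0≤u)) (bernoulli B 0≤1+u) ⟩
    ((1ℚ + u) ^ B) ^ n       ≡⟨ ^-assocʳ (1ℚ + u) B n ⟩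
    (1ℚ + u) ^ (B ℕ.* n)     ≡⟨ cong ((1ℚ + u) ^_) (ℕ.*-comm B n) ⟩
    (1ℚ + u) ^ (n ℕ.* B)     ≡⟨ ^-assocʳ (1ℚ + u) n B ⟨
    ((1ℚ + u) ^ n) ^ B       ≤⟨ ^-mono B (^-≥0 n 0≤1+u) (approx-1≤4 k) ⟩
    4ℚ ^ B                   ∎
    where
    n = 2^ k
    u : ℚ
    u = ½^ k
    0≤u : 0ℚ ≤ u
    0≤u = ½^≥0 k
    0≤1+u : 0ℚ ≤ 1ℚ + u
    0≤1+u = +-≥0 0≤1 0≤u

  0≤4^ : ∀ B → 0ℚ ≤ 4ℚ ^ B
  0≤4^ B = ^-≥0 B (ℚ.nonNegative⁻¹ 4ℚ)

  ^-close : ∀ k {a b M K d} → 1ℚ ≤ M → ∣ a ∣ ≤ M → ∣ b ∣ ≤ M → M ^ 2^ k ≤ K → 0ℚ ≤ d →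
            ∣ a - b ∣ ≤ d * ½^ k → ∣ a ^ 2^ k - b ^ 2^ k ∣ ≤ K * d
  ^-close k {a} {b} {M} {K} {d} 1≤M a≤M b≤M Mⁿ≤K 0≤d a~b = begin
    ∣ a ^ n - b ^ n ∣               ≤⟨ ^-diff n 1≤M a≤M b≤M ⟩
    fromℕ n * (M ^ n * ∣ a - b ∣)   ≤⟨ *-monoˡ (fromℕ n) (fromℕ-≥0 n) (*-mono (^-≥0 n (ℚ.≤-trans 0≤1 1≤M)) 0≤du Mⁿ≤K a~b) ⟩
    fromℕ n * (K * (d * ½^ k))      ≡⟨ solve 4 (λ n K d u → n :* (K :* (d :* u)) := n :* u :* (K :* d)) refl (fromℕ n) K d (½^ k) ⟩
    fromℕ n * ½^ k * (K * d)        ≡⟨ cong (_* (K * d)) (2^-½^ k) ⟩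
    1ℚ * (K * d)                    ≡⟨ ℚ.*-identityˡ (K * d) ⟩
    K * d                           ∎
    where
    n = 2^ k
    0≤du : 0ℚ ≤ d * ½^ k
    0≤du = *-≥0 0≤d (½^≥0 k)

  ∣1+∣≤ : ∀ {a b} → ∣ a ∣ ≤ b → ∣ 1ℚ + a ∣ ≤ 1ℚ + b
  ∣1+∣≤ {a} p = ℚ.≤-trans (ℚ.∣p+q∣≤∣p∣+∣q∣ 1ℚ a) (ℚ.+-monoʳ-≤ 1ℚ p)

  ∣*∣≤ : ∀ {a b c d} → ∣ a ∣ ≤ b → ∣ c ∣ ≤ d → ∣ a * c ∣ ≤ b * d
  ∣*∣≤ {a} {b} {c} {d} p q = subst (_≤ b * d) (sym (ℚ.∣p*q∣≡∣p∣*∣q∣ a c))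
    (*-mono (0≤∣ a ∣) (ℚ.≤-trans (0≤∣ c ∣) q) p q)

  ∣≥0∣≤ : ∀ {a} → 0ℚ ≤ a → ∣ a ∣ ≤ a
  ∣≥0∣≤ p = ℚ.≤-reflexive (ℚ.0≤p⇒∣p∣≡p p)

  approx-lipschitz : ∀ B k {q r} → ∣ q ∣ ≤ fromℕ B → ∣ r ∣ ≤ fromℕ B →
                     ∣ approx k q - approx k r ∣ ≤ 4ℚ ^ B * ∣ q - r ∣
  approx-lipschitz B k {q} {r} p p′ = ^-close k
    (1≤1+ (*-≥0 (fromℕ-≥0 B) 0≤u)) (∣1+∣≤ (∣*∣≤ p (∣≥0∣≤ 0≤u))) (∣1+∣≤ (∣*∣≤ p′ (∣≥0∣≤ 0≤u)))
    (approx≤4^ B k) (0≤∣ q - r ∣)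
    (subst (λ t → ∣ t ∣ ≤ ∣ q - r ∣ * u) eq (∣*∣≤ {q - r} ℚ.≤-refl (∣≥0∣≤ 0≤u)))
    where
    u : ℚ
    u = ½^ k
    0≤u : 0ℚ ≤ u
    0≤u = ½^≥0 k
    eq : (q - r) * u ≡ (1ℚ + q * u) - (1ℚ + r * u)
    eq = solve 3 (λ q r u → (q :- r) :* u := (con 1ℚ :+ q :* u) :- (con 1ℚ :+ r :* u)) refl q r u

  approx-step : ∀ B k {q} → ∣ q ∣ ≤ fromℕ B →
                ∣ approx (suc k) q - approx k q ∣ ≤ 4ℚ ^ B * (fromℕ B * fromℕ B * ½^ k)
  approx-step B k {q} p = subst (λ t → ∣ t - approx k q ∣ ≤ 4ℚ ^ B * (b * b * u)) (sym (^-double (1ℚ + s) k))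
    (^-close k 1≤M (∣*∣≤ 1+s≤ 1+s≤)
      (∣1+∣≤ (ℚ.≤-trans (∣*∣≤ p (∣≥0∣≤ 0≤u)) (≤-by (S * S) (*-≥0 0≤S 0≤S) refl)) ▹ eqM)
      (subst (_≤ 4ℚ ^ B) (^-double (1ℚ + S) k) (approx≤4^ B (suc k)))
      (*-≥0 (*-≥0 0≤b 0≤b) 0≤u)
      (subst₂ (λ t w → ∣ t ∣ ≤ w) eq₁ refl (ℚ.≤-trans (∣*∣≤ s≤ s≤)
        (≤-by (¾ * (b * b * u * u)) (*-≥0 (ℚ.nonNegative⁻¹ ¾) (*-≥0 (*-≥0 (*-≥0 0≤b 0≤b) 0≤u) 0≤u)) eq₂))))
    where
    b u s S ¾ : ℚ
    ¾ = 1ℚ - ½ * ½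
    b = fromℕ B
    u = ½^ k
    s = q * (½ * u)
    S = b * (½ * u)
    0≤u : 0ℚ ≤ u
    0≤u = ½^≥0 k
    0≤b : 0ℚ ≤ b
    0≤b = fromℕ-≥0 B
    0≤S : 0ℚ ≤ S
    0≤S = *-≥0 0≤b (*-≥0 0≤½ 0≤u)
    1≤1+S : 1ℚ ≤ 1ℚ + S
    1≤1+S = 1≤1+ 0≤S
    1≤M : 1ℚ ≤ (1ℚ + S) * (1ℚ + S)
    1≤M = ℚ.≤-trans 1≤1+S (≤-by (S + S * S) (+-≥0 0≤S (*-≥0 0≤S 0≤S))
      (solve 1 (λ S → con 1ℚ :+ S :+ (S :+ S :* S) := (con 1ℚ :+ S) :* (con 1ℚ :+ S)) refl S))
    s≤ : ∣ s ∣ ≤ S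
    s≤ = ∣*∣≤ p (∣≥0∣≤ (*-≥0 0≤½ 0≤u))
    1+s≤ : ∣ 1ℚ + s ∣ ≤ 1ℚ + S
    1+s≤ = ∣1+∣≤ s≤
    _▹_ : ∀ {x y z : ℚ} → x ≤ y → y ≡ z → x ≤ z
    p ▹ refl = p
    eqM : 1ℚ + (b * u + S * S) ≡ (1ℚ + S) * (1ℚ + S)
    eqM = solve 2 (λ b u → let S = b :* (con ½ :* u) in
      con 1ℚ :+ (b :* u :+ S :* S) := (con 1ℚ :+ S) :* (con 1ℚ :+ S)) refl b u
    eq₁ : s * s ≡ (1ℚ + s) * (1ℚ + s) - (1ℚ + q * u)
    eq₁ = solve 2 (λ q u → let s = q :* (con ½ :* u) in
      s :* s := (con 1ℚ :+ s) :* (con 1ℚ :+ s) :- (con 1ℚ :+ q :* u)) refl q u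
    eq₂ : S * S + ¾ * (b * b * u * u) ≡ b * b * u * u
    eq₂ = solve 2 (λ b u → let S = b :* (con ½ :* u) in
      S :* S :+ con ¾ :* (b :* b :* u :* u) := b :* b :* u :* u) refl b u

  approx-tail : ∀ B {q} → ∣ q ∣ ≤ fromℕ B → ∀ {k n} → k ℕ.≤ n →
                ∣ approx n q - approx k q ∣ ≤ 2ℚ * (4ℚ ^ B * (fromℕ B * fromℕ B)) * ½^ k
  approx-tail B {q} p {k} {n} k≤n = ℚ.≤-trans (subst (λ n → ∣ approx n q - approx k q ∣ ≤ 2ℚ * K * (½^ k - ½^ n))
      (ℕ.m∸n+n≡m k≤n) (tail (n ℕ.∸ k)))
    (*-monoˡ (2ℚ * K) (*-≥0 (ℚ.nonNegative⁻¹ 2ℚ) 0≤K) (≤-by (½^ n) (½^≥0 n)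
      (solve 2 (λ u v → u :- v :+ v := u) refl (½^ k) (½^ n))))
    where
    K : ℚ
    K = 4ℚ ^ B * (fromℕ B * fromℕ B)
    0≤K : 0ℚ ≤ K
    0≤K = *-≥0 (0≤4^ B) (*-≥0 (fromℕ-≥0 B) (fromℕ-≥0 B))
    tail : ∀ j → ∣ approx (j ℕ.+ k) q - approx k q ∣ ≤ 2ℚ * K * (½^ k - ½^ (j ℕ.+ k))
    tail zero    = ℚ.≤-reflexive (trans (cong ∣_∣ (ℚ.+-inverseʳ (approx k q)))
      (solve 2 (λ K u → con 0ℚ := con 2ℚ :* K :* (u :- u)) refl K (½^ k)))
    tail (suc j) = begin
      ∣ approx (suc m) q - approx k q ∣
        ≤⟨ ∣∣-triangle (approx (suc m) q) (approx m q) (approx k q) ⟩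
      ∣ approx (suc m) q - approx m q ∣ + ∣ approx m q - approx k q ∣
        ≤⟨ ℚ.+-mono-≤ (approx-step B m p) (tail j) ⟩
      4ℚ ^ B * (fromℕ B * fromℕ B * ½^ m) + 2ℚ * K * (½^ k - ½^ m)
        ≡⟨ solve 4 (λ c b u v → c :* (b :* b :* v) :+ con 2ℚ :* (c :* (b :* b)) :* (u :- v)
             := con 2ℚ :* (c :* (b :* b)) :* (u :- con ½ :* v)) refl (4ℚ ^ B) (fromℕ B) (½^ k) (½^ m) ⟩
      2ℚ * K * (½^ k - ½ * ½^ m) ∎
      where m = j ℕ.+ k

  approx-+ : ∀ B C k {q r} → ∣ q ∣ ≤ fromℕ B → ∣ r ∣ ≤ fromℕ C →
             ∣ approx k q * approx k r - approx k (q + r) ∣ ≤ 4ℚ ^ B * 4ℚ ^ C * (fromℕ B * fromℕ C * ½^ k)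
  approx-+ B C k {q} {r} q≤ r≤ = subst (λ t → ∣ t - approx k (q + r) ∣ ≤ K * (b * c * u))
    (^-distrib-* (1ℚ + q * u) (1ℚ + r * u) n)
    (^-close k 1≤M (∣*∣≤ (∣1+∣≤ qu≤) (∣1+∣≤ ru≤)) 1+q+r≤
      (subst (_≤ K) (sym (^-distrib-* (1ℚ + b * u) (1ℚ + c * u) n))
        (*-mono (^-≥0 n (ℚ.≤-trans 0≤1 (1≤1+ 0≤bu))) (0≤4^ C) (approx≤4^ B k) (approx≤4^ C k)))
      (*-≥0 (*-≥0 (fromℕ-≥0 B) (fromℕ-≥0 C)) 0≤u)
      (subst₂ (λ t w → ∣ t ∣ ≤ w) eq₁ eq₂ (∣*∣≤ qu≤ ru≤)))
    where
    n = 2^ k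
    u b c K : ℚ
    u = ½^ k
    b = fromℕ B
    c = fromℕ C
    K = 4ℚ ^ B * 4ℚ ^ C
    0≤u : 0ℚ ≤ u
    0≤u = ½^≥0 k
    0≤bu : 0ℚ ≤ b * u
    0≤bu = *-≥0 (fromℕ-≥0 B) 0≤u
    0≤cu : 0ℚ ≤ c * u
    0≤cu = *-≥0 (fromℕ-≥0 C) 0≤u
    qu≤ : ∣ q * u ∣ ≤ b * u
    qu≤ = ∣*∣≤ q≤ (∣≥0∣≤ 0≤u)
    ru≤ : ∣ r * u ∣ ≤ c * u
    ru≤ = ∣*∣≤ r≤ (∣≥0∣≤ 0≤u)
    1≤M : 1ℚ ≤ (1ℚ + b * u) * (1ℚ + c * u)
    1≤M = ≤-by (b * u + (1ℚ + b * u) * (c * u)) (+-≥0 0≤bu (*-≥0 (ℚ.≤-trans 0≤1 (1≤1+ 0≤bu)) 0≤cu))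
      (solve 3 (λ b c u → con 1ℚ :+ (b :* u :+ (con 1ℚ :+ b :* u) :* (c :* u))
        := (con 1ℚ :+ b :* u) :* (con 1ℚ :+ c :* u)) refl b c u)
    1+q+r≤ : ∣ 1ℚ + (q + r) * u ∣ ≤ (1ℚ + b * u) * (1ℚ + c * u)
    1+q+r≤ = ℚ.≤-trans (∣1+∣≤ (subst (λ t → ∣ t ∣ ≤ b * u + c * u) (sym (ℚ.*-distribʳ-+ u q r))
        (ℚ.≤-trans (ℚ.∣p+q∣≤∣p∣+∣q∣ (q * u) (r * u)) (ℚ.+-mono-≤ qu≤ ru≤))))
      (≤-by (b * u * (c * u)) (*-≥0 0≤bu 0≤cu)
        (solve 3 (λ b c u → con 1ℚ :+ (b :* u :+ c :* u) :+ b :* u :* (c :* u)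
          := (con 1ℚ :+ b :* u) :* (con 1ℚ :+ c :* u)) refl b c u))
    eq₁ : q * u * (r * u) ≡ (1ℚ + q * u) * (1ℚ + r * u) - (1ℚ + (q + r) * u)
    eq₁ = solve 3 (λ q r u → q :* u :* (r :* u)
      := (con 1ℚ :+ q :* u) :* (con 1ℚ :+ r :* u) :- (con 1ℚ :+ (q :+ r) :* u)) refl q r u
    eq₂ : b * u * (c * u) ≡ b * c * u * u
    eq₂ = solve 3 (λ b c u → b :* u :* (c :* u) := b :* c :* u :* u) refl b c u

  approx-0 : ∀ k → approx k 0ℚ ≡ 1ℚ
  approx-0 k = trans (cong (_^ 2^ k) (trans (cong (1ℚ +_) (ℚ.*-zeroˡ (½^ k))) refl)) (1^ (2^ k))

  approx-≥1+ : ∀ k {q} → 0ℚ ≤ 1ℚ + q * ½^ k → 1ℚ + q ≤ approx k q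
  approx-≥1+ k {q} p = ℚ.≤-trans (ℚ.≤-reflexive eq) (bernoulli (2^ k) p)
    where
    eq : 1ℚ + q ≡ 1ℚ + fromℕ (2^ k) * (q * ½^ k)
    eq = cong (1ℚ +_) (begin-equality
      q                              ≡⟨ ℚ.*-identityʳ q ⟨
      q * 1ℚ                         ≡⟨ cong (q *_) (2^-½^ k) ⟨
      q * (fromℕ (2^ k) * ½^ k)      ≡⟨ solve 3 (λ q n u → q :* (n :* u) := n :* (q :* u)) refl q (fromℕ (2^ k)) (½^ k) ⟩
      fromℕ (2^ k) * (q * ½^ k)      ∎)

  approx-base : ∀ B → ∃ λ N → ∀ k → N ℕ.≤ k → ∀ {q} → ∣ q ∣ ≤ fromℕ B → 0ℚ ≤ 1ℚ + q * ½^ k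
  approx-base B = proj₁ small , λ k N≤k {q} q≤ → ℚ.≤-trans (diff≥0 (proj₂ small k N≤k))
    (≤-by ((fromℕ B - (- q)) * ½^ k) (*-≥0 (diff≥0 (ℚ.≤-trans (-a≤∣a∣ q) q≤)) (½^≥0 k))
      (solve 3 (λ b q u → con 1ℚ :- b :* u :+ (b :- (:- q)) :* u := con 1ℚ :+ q :* u) refl (fromℕ B) q (½^ k)))
    where
    small : ∃ λ N → ∀ n → N ℕ.≤ n → fromℕ B * ½^ n ≤ 1ℚ
    small = ½^-small (fromℕ B) (fromℕ-≥0 B) 0<1

  approx-positive : ∀ B → ∃ λ δ → 0ℚ < δ × ∃ λ N → ∀ k → N ℕ.≤ k → ∀ {q} → ∣ q ∣ ≤ fromℕ B → δ ≤ approx k q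
  approx-positive B = δ , *->0 0<½ (inverse>0 0<4^B) , proj₁ small ℕ.⊔ proj₁ (approx-base B) , bound
    where
    0<4^B : 0ℚ < 4ℚ ^ B
    0<4^B = ^->0 B (ℚ.positive⁻¹ 4ℚ)
    δ K : ℚ
    δ = ½ * inverse (4ℚ ^ B)
    K = 4ℚ ^ B * 4ℚ ^ B * (fromℕ B * fromℕ B)
    small : ∃ λ N → ∀ n → N ℕ.≤ n → K * ½^ n ≤ ½
    small = ½^-small K (*-≥0 (*-≥0 (0≤4^ B) (0≤4^ B)) (*-≥0 (fromℕ-≥0 B) (fromℕ-≥0 B))) 0<½
    bound : ∀ k → proj₁ small ℕ.⊔ proj₁ (approx-base B) ℕ.≤ k → ∀ {q} → ∣ q ∣ ≤ fromℕ B → δ ≤ approx k q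
    bound k N≤k {q} q≤ = cancel-≤ (4ℚ ^ B) 0<4^B (begin
      ½ * inverse (4ℚ ^ B) * 4ℚ ^ B   ≡⟨ ℚ.*-assoc ½ (inverse (4ℚ ^ B)) (4ℚ ^ B) ⟩
      ½ * (inverse (4ℚ ^ B) * 4ℚ ^ B) ≡⟨ cong (½ *_) (inverse-*ˡ 0<4^B) ⟩
      ½ * 1ℚ                          ≡⟨⟩
      1ℚ - ½                          ≤⟨ ≤-by _ (diff≥0 near) (solve 1 (λ p → con 1ℚ :- con ½ :+ (p :+ con ½ :- con 1ℚ) := p) refl (approx k q * approx k (- q))) ⟩
      approx k q * approx k (- q)     ≤⟨ *-monoˡ (approx k q) (^-≥0 (2^ k) base) (ℚ.≤-trans (a≤∣a∣ (approx k (- q))) -q≤4^) ⟩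
      approx k q * 4ℚ ^ B ∎)
      where
      -q≤ : ∣ - q ∣ ≤ fromℕ B
      -q≤ = subst (_≤ fromℕ B) (sym (ℚ.∣-p∣≡∣p∣ q)) q≤
      base : 0ℚ ≤ 1ℚ + q * ½^ k
      base = proj₂ (approx-base B) k (ℕ.≤-trans (ℕ.m≤n⊔m (proj₁ small) _) N≤k) q≤
      base′ : 0ℚ ≤ 1ℚ + - q * ½^ k
      base′ = proj₂ (approx-base B) k (ℕ.≤-trans (ℕ.m≤n⊔m (proj₁ small) _) N≤k) -q≤
      -q≤4^ : ∣ approx k (- q) ∣ ≤ 4ℚ ^ B
      -q≤4^ = ℚ.≤-trans (∣≥0∣≤ (^-≥0 (2^ k) base′)) (ℚ.≤-trans
        (^-mono (2^ k) base′ (ℚ.+-monoʳ-≤ 1ℚ (*-monoʳ (½^ k) (½^≥0 k) (ℚ.≤-trans (a≤∣a∣ (- q)) -q≤))))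
        (approx≤4^ B k))
      near : 1ℚ ≤ approx k q * approx k (- q) + ½
      near = near⇒≥ {approx k q * approx k (- q)} (subst (λ t → ∣ approx k q * approx k (- q) - t ∣ ≤ ½)
        (trans (cong (approx k) (ℚ.+-inverseʳ q)) (approx-0 k))
        (ℚ.≤-trans (approx-+ B B k q≤ -q≤) (subst (_≤ ½) (ℚ.*-assoc (4ℚ ^ B * 4ℚ ^ B) _ _)
          (proj₂ small k (ℕ.≤-trans (ℕ.m≤m⊔n _ (proj₁ (approx-base B))) N≤k)))))

  ∣∣-+ : ∀ {a b c d δ ε} → ∣ a - c ∣ ≤ δ → ∣ b - d ∣ ≤ ε → ∣ (a + b) - (c + d) ∣ ≤ δ + ε
  ∣∣-+ {a} {b} {c} {d} {δ} {ε} p q = subst (λ t → ∣ t ∣ ≤ δ + ε)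
    (solve 4 (λ a b c d → (a :- c) :+ (b :- d) := (a :+ b) :- (c :+ d)) refl a b c d)
    (ℚ.≤-trans (ℚ.∣p+q∣≤∣p∣+∣q∣ (a - c) (b - d)) (ℚ.+-mono-≤ p q))

  ∣∣-neg : ∀ {a b ε} → ∣ a - b ∣ ≤ ε → ∣ (- a) - (- b) ∣ ≤ ε
  ∣∣-neg {a} {b} {ε} p = subst (λ t → ∣ t ∣ ≤ ε)
    (solve 2 (λ a b → b :- a := (:- a) :- (:- b)) refl a b) (subst (_≤ ε) (∣∣-comm a b) p)

  ∣∣-* : ∀ {a b c d A D δ ε} → ∣ a ∣ ≤ A → ∣ d ∣ ≤ D → ∣ a - c ∣ ≤ δ → ∣ b - d ∣ ≤ ε →
         ∣ a * b - c * d ∣ ≤ A * ε + D * δ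
  ∣∣-* {a} {b} {c} {d} {A} {D} {δ} {ε} a≤ d≤ p q = subst (λ t → ∣ t ∣ ≤ A * ε + D * δ)
    (solve 4 (λ a b c d → a :* (b :- d) :+ d :* (a :- c) := a :* b :- c :* d) refl a b c d)
    (ℚ.≤-trans (ℚ.∣p+q∣≤∣p∣+∣q∣ (a * (b - d)) (d * (a - c))) (ℚ.+-mono-≤ (∣*∣≤ a≤ q) (∣*∣≤ d≤ p)))

  ∣∣-⊔ : ∀ {a b c d ε} → ∣ a - c ∣ ≤ ε → ∣ b - d ∣ ≤ ε → ∣ (a ⊔ b) - (c ⊔ d) ∣ ≤ ε
  ∣∣-⊔ {a} {b} {c} {d} {ε} p q = ≤⇒near
    (ℚ.⊔-lub (ℚ.≤-trans (near⇒≤ {a} p) (ℚ.+-monoˡ-≤ ε (ℚ.p≤p⊔q c d))) (ℚ.≤-trans (near⇒≤ {b} q) (ℚ.+-monoˡ-≤ ε (ℚ.p≤q⊔p c d))))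
    (ℚ.⊔-lub (ℚ.≤-trans (near⇒≥ {a} p) (ℚ.+-monoˡ-≤ ε (ℚ.p≤p⊔q a b))) (ℚ.≤-trans (near⇒≥ {b} q) (ℚ.+-monoˡ-≤ ε (ℚ.p≤q⊔p a b))))

  ∣∣-inverse : ∀ {a b δ ε} → 0ℚ < δ → δ ≤ a → δ ≤ b → ∣ a - b ∣ ≤ ε →
               ∣ inverse a - inverse b ∣ ≤ inverse δ * inverse δ * ε
  ∣∣-inverse {a} {b} {δ} {ε} 0<δ δ≤a δ≤b p = subst (λ t → ∣ t ∣ ≤ inverse δ * inverse δ * ε) eq
    (∣*∣≤ (∣*∣≤ (inv≤ 0<a δ≤a) (inv≤ 0<b δ≤b)) (subst (_≤ ε) (∣∣-comm a b) p))
    where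
    0<a : 0ℚ < a
    0<a = ℚ.<-≤-trans 0<δ δ≤a
    0<b : 0ℚ < b
    0<b = ℚ.<-≤-trans 0<δ δ≤b
    inv≤ : ∀ {c} → 0ℚ < c → δ ≤ c → ∣ inverse c ∣ ≤ inverse δ
    inv≤ 0<c δ≤c = ℚ.≤-trans (∣≥0∣≤ (ℚ.<⇒≤ (inverse>0 0<c))) (inverse-anti 0<δ δ≤c)
    eq : inverse a * inverse b * (b - a) ≡ inverse a - inverse b
    eq = begin-equality
      inverse a * inverse b * (b - a)
        ≡⟨ solve 4 (λ a b i j → i :* j :* (b :- a) := i :* (j :* b) :- j :* (i :* a)) refl a b (inverse a) (inverse b) ⟩
      inverse a * (inverse b * b) - inverse b * (inverse a * a)
        ≡⟨ cong₂ (λ s t → inverse a * s - inverse b * t) (inverse-*ˡ 0<b) (inverse-*ˡ 0<a) ⟩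
      inverse a * 1ℚ - inverse b * 1ℚ
        ≡⟨ cong₂ _-_ (ℚ.*-identityʳ (inverse a)) (ℚ.*-identityʳ (inverse b)) ⟩
      inverse a - inverse b ∎

  shrink : ∀ K {ε} → 0ℚ ≤ K → 0ℚ < ε → ∃ λ δ → 0ℚ < δ × K * δ ≤ ε
  shrink K {ε} 0≤K 0<ε = ε * inverse (1ℚ + K) , *->0 0<ε (inverse>0 0<1+K) , (begin
    K * (ε * inverse (1ℚ + K))
      ≤⟨ ≤-by (ε * inverse (1ℚ + K)) (*-≥0 (ℚ.<⇒≤ 0<ε) (ℚ.<⇒≤ (inverse>0 0<1+K)))
           (solve 3 (λ K ε i → K :* (ε :* i) :+ ε :* i := ε :* (i :* (con 1ℚ :+ K))) refl K ε (inverse (1ℚ + K))) ⟩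
    ε * (inverse (1ℚ + K) * (1ℚ + K))  ≡⟨ cong (ε *_) (inverse-*ˡ 0<1+K) ⟩
    ε * 1ℚ                             ≡⟨ ℚ.*-identityʳ ε ⟩
    ε ∎)
    where
    0<1+K : 0ℚ < 1ℚ + K
    0<1+K = +->0 0<1 0≤K

  2shrink : ∀ K L {ε} → 0ℚ ≤ K → 0ℚ ≤ L → 0ℚ < ε → ∃ λ δ → 0ℚ < δ × K * δ + L * δ ≤ ε
  2shrink K L 0≤K 0≤L 0<ε = proj₁ s , proj₁ (proj₂ s) , subst (_≤ _) (ℚ.*-distribʳ-+ (proj₁ s) K L) (proj₂ (proj₂ s))
    where s = shrink (K + L) (+-≥0 0≤K 0≤L) 0<ε

  approx-< : ∀ {u v} → u < v → ∃ λ ε → 0ℚ < ε × ∃ λ N → ∀ k → N ℕ.≤ k → approx k u + ε ≤ approx k v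
  approx-< {u} {v} u<v = η , 0<η , proj₁ (proj₂ (proj₂ pos)) ℕ.⊔ (proj₁ (approx-base B) ℕ.⊔ proj₁ small) , bound
    where
    d : ℚ
    d = v - u
    0<d : 0ℚ < d
    0<d = diff>0 u<v
    arch : ∃ λ n → ∣ u ∣ + ∣ d ∣ ≤ fromℕ n
    arch = archimedean (∣ u ∣ + ∣ d ∣)
    B : ℕ
    B = proj₁ arch
    u≤ : ∣ u ∣ ≤ fromℕ B
    u≤ = ℚ.≤-trans (≤-by ∣ d ∣ (0≤∣ d ∣) refl) (proj₂ arch)
    d≤ : ∣ d ∣ ≤ fromℕ B
    d≤ = ℚ.≤-trans (≤-by ∣ u ∣ (0≤∣ u ∣) (ℚ.+-comm ∣ d ∣ ∣ u ∣)) (proj₂ arch)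
    pos : ∃ λ δ → 0ℚ < δ × ∃ λ N → ∀ k → N ℕ.≤ k → ∀ {q} → ∣ q ∣ ≤ fromℕ B → δ ≤ approx k q
    pos = approx-positive B
    δ η K : ℚ
    δ = proj₁ pos
    η = ½ * (δ * d)
    K = 4ℚ ^ B * 4ℚ ^ B * (fromℕ B * fromℕ B)
    0<η : 0ℚ < η
    0<η = half>0 (*->0 (proj₁ (proj₂ pos)) 0<d)
    small : ∃ λ N → ∀ n → N ℕ.≤ n → K * ½^ n ≤ η
    small = ½^-small K (*-≥0 (*-≥0 (0≤4^ B) (0≤4^ B)) (*-≥0 (fromℕ-≥0 B) (fromℕ-≥0 B))) 0<η
    bound : ∀ k → proj₁ (proj₂ (proj₂ pos)) ℕ.⊔ (proj₁ (approx-base B) ℕ.⊔ proj₁ small) ℕ.≤ k → approx k u + η ≤ approx k v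
    bound k N≤k = begin
      a + η                            ≡⟨ solve 2 (λ a t → a :+ con ½ :* t := a :+ t :- con ½ :* t) refl a (δ * d) ⟩
      a + δ * d - η                    ≤⟨ ℚ.+-monoˡ-≤ (- η) (ℚ.+-monoʳ-≤ a (*-monoʳ d (ℚ.<⇒≤ 0<d) δ≤a)) ⟩
      a + a * d - η                    ≡⟨ solve 3 (λ a d η → a :+ a :* d :- η := a :* (con 1ℚ :+ d) :- η) refl a d η ⟩
      a * (1ℚ + d) - η                 ≤⟨ ℚ.+-monoˡ-≤ (- η) (*-monoˡ a 0≤a (approx-≥1+ k {d} (proj₂ (approx-base B) k N₂ d≤))) ⟩
      a * approx k d - η               ≤⟨ ≤-by _ (diff≥0 near) (solve 3 (λ p q η → p :- η :+ (q :+ η :- p) := q) refl (a * approx k d) (approx k (u + d)) η) ⟩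
      approx k (u + d)                 ≡⟨ cong (approx k) (solve 2 (λ u v → u :+ (v :- u) := v) refl u v) ⟩
      approx k v                       ∎
      where
      N₁ : proj₁ (proj₂ (proj₂ pos)) ℕ.≤ k
      N₁ = ℕ.≤-trans (ℕ.m≤m⊔n _ (proj₁ (approx-base B) ℕ.⊔ proj₁ small)) N≤k
      N₂₃ : proj₁ (approx-base B) ℕ.⊔ proj₁ small ℕ.≤ k
      N₂₃ = ℕ.≤-trans (ℕ.m≤n⊔m (proj₁ (proj₂ (proj₂ pos))) _) N≤k
      N₂ : proj₁ (approx-base B) ℕ.≤ k
      N₂ = ℕ.≤-trans (ℕ.m≤m⊔n _ (proj₁ small)) N₂₃
      N₃ : proj₁ small ℕ.≤ k
      N₃ = ℕ.≤-trans (ℕ.m≤n⊔m (proj₁ (approx-base B)) _) N₂₃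
      a : ℚ
      a = approx k u
      δ≤a : δ ≤ a
      δ≤a = proj₂ (proj₂ (proj₂ pos)) k N₁ u≤
      0≤a : 0ℚ ≤ a
      0≤a = ℚ.≤-trans (ℚ.<⇒≤ (proj₁ (proj₂ pos))) δ≤a
      near : a * approx k d ≤ approx k (u + d) + η
      near = near⇒≤ {a * approx k d} (ℚ.≤-trans (approx-+ B B k u≤ d≤)
        (subst (_≤ η) (ℚ.*-assoc (4ℚ ^ B * 4ℚ ^ B) _ _) (proj₂ small k N₃)))

  approx-large : ∀ B k → 1ℚ + fromℕ B ≤ approx k (fromℕ B)
  approx-large B k = approx-≥1+ k {fromℕ B} (+-≥0 0≤1 (*-≥0 (fromℕ-≥0 B) (½^≥0 k)))

  opaque
    approx-small : ∀ {ε} → 0ℚ < ε → ∃ λ A → ∃ λ N → ∀ k → N ℕ.≤ k → approx k (- fromℕ A) ≤ ε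
    approx-small {ε} 0<ε = A , proj₁ (approx-base A) , λ k N≤k → let
        u : ℚ
        u = ½^ k
        n : ℕ
        n = 2^ k
        base : 0ℚ ≤ 1ℚ + - fromℕ A * u
        base = proj₂ (approx-base A) k N≤k (ℚ.≤-reflexive (trans (ℚ.∣-p∣≡∣p∣ (fromℕ A)) (ℚ.0≤p⇒∣p∣≡p (fromℕ-≥0 A))))
        base′ : 0ℚ ≤ 1ℚ + fromℕ A * u
        base′ = +-≥0 0≤1 (*-≥0 (fromℕ-≥0 A) (½^≥0 k))
        Au≥0 : 0ℚ ≤ fromℕ A * u
        Au≥0 = *-≥0 (fromℕ-≥0 A) (½^≥0 k)
      in cancel-≤ (1ℚ + fromℕ A) 0<1+A (begin
        approx k (- fromℕ A) * (1ℚ + fromℕ A)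
          ≤⟨ *-monoˡ (approx k (- fromℕ A)) (^-≥0 n base) (approx-large A k) ⟩
        approx k (- fromℕ A) * approx k (fromℕ A)
          ≡⟨ ^-distrib-* (1ℚ + - fromℕ A * u) (1ℚ + fromℕ A * u) n ⟨
        ((1ℚ + - fromℕ A * u) * (1ℚ + fromℕ A * u)) ^ n
          ≤⟨ ^-mono n (*-≥0 base base′) (≤-by (fromℕ A * u * (fromℕ A * u)) (*-≥0 Au≥0 Au≥0)
               (solve 2 (λ a u → (con 1ℚ :+ :- a :* u) :* (con 1ℚ :+ a :* u) :+ a :* u :* (a :* u) := con 1ℚ) refl (fromℕ A) u)) ⟩
        1ℚ ^ n
          ≡⟨ 1^ n ⟩
        1ℚ
          ≤⟨ proj₂ arch ⟩
        ε * fromℕ A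
          ≤⟨ ≤-by ε (ℚ.<⇒≤ 0<ε) (solve 2 (λ ε a → ε :* a :+ ε := ε :* (con 1ℚ :+ a)) refl ε (fromℕ A)) ⟩
        ε * (1ℚ + fromℕ A) ∎)
      where
      arch : ∃ λ n → 1ℚ ≤ ε * fromℕ n
      arch = archimedean′ 1ℚ 0<ε
      A : ℕ
      A = proj₁ arch
      0<1+A : 0ℚ < 1ℚ + fromℕ A
      0<1+A = +->0 0<1 (fromℕ-≥0 A)

  approx-near-1 : ∀ {ε} → 0ℚ < ε → ∃ λ c → 0ℚ < c × (∀ k → approx k c ≤ 1ℚ + ε)
  approx-near-1 {ε} 0<ε = c , 0<c , λ k → ℚ.≤-trans (near⇒≤ {approx k c}
      (ℚ.≤-trans (approx-lipschitz 1 k {c} {0ℚ} (ℚ.≤-trans (∣≥0∣≤ 0≤c) c≤1) 0≤1)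
        (subst (λ t → 4ℚ ^ 1 * ∣ t ∣ ≤ ε) (sym (ℚ.+-identityʳ c))
          (ℚ.≤-trans (*-monoˡ (4ℚ ^ 1) (0≤4^ 1) (∣≥0∣≤ 0≤c)) 4c≤ε))))
      (ℚ.≤-reflexive (cong (_+ ε) (approx-0 k)))
    where
    0<θ : 0ℚ < ε ⊓ 1ℚ
    0<θ with ℚ.⊓-sel ε 1ℚ
    ... | inj₁ e = subst (0ℚ <_) (sym e) 0<ε
    ... | inj₂ e = subst (0ℚ <_) (sym e) 0<1
    s : ∃ λ δ → 0ℚ < δ × 4ℚ * δ ≤ ε ⊓ 1ℚ
    s = shrink 4ℚ (ℚ.nonNegative⁻¹ 4ℚ) 0<θ
    c : ℚ
    c = proj₁ s
    0<c : 0ℚ < c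
    0<c = proj₁ (proj₂ s)
    0≤c : 0ℚ ≤ c
    0≤c = ℚ.<⇒≤ 0<c
    4c≤ε : 4ℚ ^ 1 * c ≤ ε
    4c≤ε = ℚ.≤-trans (proj₂ (proj₂ s)) (ℚ.p⊓q≤p ε 1ℚ)
    c≤1 : c ≤ fromℕ 1
    c≤1 = ℚ.≤-trans (≤-by (c + (c + c)) (+-≥0 0≤c (+-≥0 0≤c 0≤c))
        (solve 1 (λ c → c :+ (c :+ (c :+ c)) := con 4ℚ :* c) refl c))
      (ℚ.≤-trans (proj₂ (proj₂ s)) (ℚ.p⊓q≤q ε 1ℚ))

  compare-lower : ∀ {xN xn zN zn h} → ∣ xn - xN ∣ ≤ ½ * h → ∣ zn - zN ∣ ≤ ½ * h →
                  xN + 2ℚ * h ≤ zN → xn + h ≤ zn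
  compare-lower {xN} {xn} {zN} {zn} {h} p q r = ≤-by
    ((xN + ½ * h - xn) + (zn + ½ * h - zN) + (zN - (xN + 2ℚ * h)))
    (+-≥0 (+-≥0 (diff≥0 (near⇒≤ {xn} p)) (diff≥0 (near⇒≥ {zn} q))) (diff≥0 r))
    (solve 5 (λ xN xn zN zn h → xn :+ h :+ ((xN :+ con ½ :* h :- xn) :+ (zn :+ con ½ :* h :- zN) :+ (zN :- (xN :+ con 2ℚ :* h)))
       := zn) refl xN xn zN zn h)

  third : ℚ → ℚ → ℚ
  third a b = a + ⅓ * (b - a)

  third-< : ∀ {a b} → a < b → third a b < third b a
  third-< {a} {b} a<b = <-by (⅓ * (b - a)) (*->0 (ℚ.positive⁻¹ ⅓) (diff>0 a<b))
    (solve 2 (λ a b → a :+ con ⅓ :* (b :- a) :+ con ⅓ :* (b :- a) := b :+ con ⅓ :* (a :- b)) refl a b)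

  third-≥ : ∀ {a b} → a < b → a ≤ third a b
  third-≥ {a} {b} a<b = ≤-by (⅓ * (b - a)) (ℚ.<⇒≤ (*->0 (ℚ.positive⁻¹ ⅓) (diff>0 a<b))) refl

  third-≤ : ∀ {a b} → a < b → third b a ≤ b
  third-≤ {a} {b} a<b = ≤-by (⅓ * (b - a)) (ℚ.<⇒≤ (*->0 (ℚ.positive⁻¹ ⅓) (diff>0 a<b)))
    (solve 2 (λ a b → b :+ con ⅓ :* (a :- b) :+ con ⅓ :* (b :- a) := b) refl a b)

  third-width : ∀ a b → b - third a b ≡ (⅓ + ⅓) * (b - a)
  third-width = solve 2 (λ a b → b :- (a :+ con ⅓ :* (b :- a)) := con (⅓ + ⅓) :* (b :- a)) refl

  third-width′ : ∀ a b → third b a - a ≡ (⅓ + ⅓) * (b - a)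
  third-width′ = solve 2 (λ a b → (b :+ con ⅓ :* (a :- b)) :- a := con (⅓ + ⅓) :* (b :- a)) refl

open Rational using (inverse; approx; 2ℚ; ⅓)

-- Two sequences are close when they are Cauchy with the same limit; a sequence
-- close to itself is a Cauchy sequence.
record Close (f g : ℕ → ℚ) : Set where
  constructor mkClose
  field within : ∀ {ε} → 0ℚ ℚ.< ε → ∃ λ N → ∀ m n → N ℕ.≤ m → N ℕ.≤ n → ∣ f m ℚ.- g n ∣ ℚ.≤ ε

open Close public

record ℝ : Set where
  no-eta-equality
  constructor mkℝ
  field
    seq    : ℕ → ℚ
    cauchy : Close seq seq

open ℝ public

infix 4 _≈_ _≤_ _<_

record _≈_ (x y : ℝ) : Set where
  constructor mk≈
  field close : Close (seq x) (seq y)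

record _≤_ (x y : ℝ) : Set where
  constructor mk≤
  field below : ∀ {ε} → 0ℚ ℚ.< ε → ∃ λ N → ∀ n → N ℕ.≤ n → seq x n ℚ.≤ seq y n ℚ.+ ε

record _<_ (x y : ℝ) : Set where
  constructor mk<
  field apart : ∃ λ ε → 0ℚ ℚ.< ε × ∃ λ N → ∀ n → N ℕ.≤ n → seq x n ℚ.+ ε ℚ.≤ seq y n

open _≈_ public
open _≤_ public
open _<_ public

module Closeness where
  open Rational

  -- opaque, so that unification recovers its arguments
  opaque
    infixl 6 _∨_

    _∨_ : ℕ → ℕ → ℕ
    _∨_ = ℕ._⊔_

    ∨ˡ : ∀ {i j n} → i ∨ j ℕ.≤ n → i ℕ.≤ n
    ∨ˡ {i} {j} = ℕ.≤-trans (ℕ.m≤m⊔n i j)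

    ∨ʳ : ∀ {i j n} → i ∨ j ℕ.≤ n → j ℕ.≤ n
    ∨ʳ {i} {j} = ℕ.≤-trans (ℕ.m≤n⊔m i j)

  opaque
    const-close : ∀ q → Close (λ _ → q) (λ _ → q)
    const-close q = mkClose λ {ε} 0<ε →
      0 , λ _ _ _ _ → subst (λ t → ∣ t ∣ ℚ.≤ ε) (sym (ℚ.+-inverseʳ q)) (ℚ.<⇒≤ 0<ε)

    close-sym : ∀ {f g} → Close f g → Close g f
    close-sym {f} {g} p = mkClose λ {ε} 0<ε → proj₁ (within p 0<ε) , λ m n N≤m N≤n →
      subst (ℚ._≤ ε) (∣∣-comm (f n) (g m)) (proj₂ (within p 0<ε) n m N≤n N≤m)

    neg-close : ∀ {f g} → Close f g → Close (λ n → ℚ.- f n) (λ n → ℚ.- g n)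
    neg-close {f} {g} p = mkClose λ 0<ε → proj₁ (within p 0<ε) , λ m n N≤m N≤n →
      ∣∣-neg {f m} {g n} (proj₂ (within p 0<ε) m n N≤m N≤n)

    +-close : ∀ {f f′ g g′} → Close f f′ → Close g g′ → Close (λ n → f n ℚ.+ g n) (λ n → f′ n ℚ.+ g′ n)
    +-close {f} {f′} {g} {g′} p q = mkClose λ {ε} 0<ε → let
        P = within p (half>0 0<ε)
        Q = within q (half>0 0<ε)
      in proj₁ P ∨ proj₁ Q , λ m n N≤m N≤n → ℚ.≤-trans
        (∣∣-+ {f m} {g m} {f′ n} {g′ n} (proj₂ P m n (∨ˡ N≤m) (∨ˡ N≤n)) (proj₂ Q m n (∨ʳ N≤m) (∨ʳ N≤n)))
        (ℚ.≤-reflexive (halves ε))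

    ⊔-close : ∀ {f f′ g g′} → Close f f′ → Close g g′ → Close (λ n → f n ℚ.⊔ g n) (λ n → f′ n ℚ.⊔ g′ n)
    ⊔-close {f} {f′} {g} {g′} p q = mkClose λ 0<ε → let
        P = within p 0<ε
        Q = within q 0<ε
      in proj₁ P ∨ proj₁ Q , λ m n N≤m N≤n →
        ∣∣-⊔ {f m} {g m} {f′ n} {g′ n} (proj₂ P m n (∨ˡ N≤m) (∨ˡ N≤n)) (proj₂ Q m n (∨ʳ N≤m) (∨ʳ N≤n))

  opaque
    bounded : ∀ {f g} → Close f g → ∃ λ B → ∃ λ N → ∀ n → N ℕ.≤ n → ∣ f n ∣ ℚ.≤ fromℕ B
    bounded {f} {g} p = suc (proj₁ A) , N , λ n N≤n → begin
        ∣ f n ∣                                ≡⟨ cong ∣_∣ (solve 2 (λ a b → a := (a :- b) :+ b) refl (f n) (g N)) ⟩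
        ∣ (f n ℚ.- g N) ℚ.+ g N ∣              ≤⟨ ℚ.∣p+q∣≤∣p∣+∣q∣ (f n ℚ.- g N) (g N) ⟩
        ∣ f n ℚ.- g N ∣ ℚ.+ ∣ g N ∣            ≤⟨ ℚ.+-mono-≤ (proj₂ (within p 0<1) n N N≤n ℕ.≤-refl) (proj₂ A) ⟩
        1ℚ ℚ.+ fromℕ (proj₁ A)                 ∎
      where
      open ℚ.≤-Reasoning
      open +-*-Solver
      N : ℕ
      N = proj₁ (within p 0<1)
      A : ∃ λ n → ∣ g N ∣ ℚ.≤ fromℕ n
      A = archimedean ∣ g N ∣

  opaque
    *-close : ∀ {f f′ g g′} → Close f f′ → Close g g′ → Close (λ n → f n ℚ.* g n) (λ n → f′ n ℚ.* g′ n)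
    *-close {f} {f′} {g} {g′} p q = mkClose λ 0<ε → let
        δ = 2shrink (fromℕ (proj₁ F)) (fromℕ (proj₁ G)) (fromℕ-≥0 (proj₁ F)) (fromℕ-≥0 (proj₁ G)) 0<ε
        P = within p (proj₁ (proj₂ δ))
        Q = within q (proj₁ (proj₂ δ))
      in (proj₁ P ∨ proj₁ Q) ∨ (proj₁ (proj₂ F) ∨ proj₁ (proj₂ G)) , λ m n N≤m N≤n → ℚ.≤-trans
        (∣∣-* {f m} {g m} {f′ n} {g′ n} (proj₂ (proj₂ F) m (∨ˡ (∨ʳ N≤m))) (proj₂ (proj₂ G) n (∨ʳ (∨ʳ N≤n)))
          (proj₂ P m n (∨ˡ (∨ˡ N≤m)) (∨ˡ (∨ˡ N≤n))) (proj₂ Q m n (∨ʳ (∨ˡ N≤m)) (∨ʳ (∨ˡ N≤n))))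
        (proj₂ (proj₂ δ))
      where
      F : ∃ λ B → ∃ λ N → ∀ n → N ℕ.≤ n → ∣ f n ∣ ℚ.≤ fromℕ B
      F = bounded p
      G : ∃ λ B → ∃ λ N → ∀ n → N ℕ.≤ n → ∣ g′ n ∣ ℚ.≤ fromℕ B
      G = bounded (close-sym q)

  EventuallyPositive : (ℕ → ℚ) → Set
  EventuallyPositive f = ∃ λ δ → 0ℚ ℚ.< δ × ∃ λ N → ∀ n → N ℕ.≤ n → 0ℚ ℚ.+ δ ℚ.≤ f n

  opaque
    inverse-close : ∀ {f g} → EventuallyPositive f → EventuallyPositive g → Close f g →
                    Close (λ n → inverse (f n)) (λ n → inverse (g n))
    inverse-close {f} {g} (δ , 0<δ , N , δ≤f) (η , 0<η , M , η≤g) p = mkClose λ 0<ε → let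
        S = shrink (inverse θ ℚ.* inverse θ) (*-≥0 0≤i 0≤i) 0<ε
        P = within p (proj₁ (proj₂ S))
      in (N ∨ M) ∨ proj₁ P , λ m n N≤m N≤n → ℚ.≤-trans
        (∣∣-inverse {f m} {g n} 0<θ
          (ℚ.≤-trans (ℚ.p⊓q≤p δ η) (subst (ℚ._≤ f m) (ℚ.+-identityˡ δ) (δ≤f m (∨ˡ (∨ˡ N≤m)))))
          (ℚ.≤-trans (ℚ.p⊓q≤q δ η) (subst (ℚ._≤ g n) (ℚ.+-identityˡ η) (η≤g n (∨ʳ (∨ˡ N≤n)))))
          (proj₂ P m n (∨ʳ N≤m) (∨ʳ N≤n)))
        (proj₂ (proj₂ S))
      where
      θ : ℚ
      θ = δ ℚ.⊓ η
      0<θ : 0ℚ ℚ.< θ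
      0<θ with ℚ.⊓-sel δ η
      ... | inj₁ e = subst (0ℚ ℚ.<_) (sym e) 0<δ
      ... | inj₂ e = subst (0ℚ ℚ.<_) (sym e) 0<η
      0≤i : 0ℚ ℚ.≤ inverse θ
      0≤i = ℚ.<⇒≤ (inverse>0 0<θ)

  module ExpClose {f g : ℕ → ℚ} (p : Close f g) {ε} (0<ε : 0ℚ ℚ.< ε) where
    F = bounded p
    G = bounded (close-sym p)
    B = proj₁ F ∨ proj₁ G
    h K : ℚ
    h = ½ ℚ.* (½ ℚ.* ε)
    K = 2ℚ ℚ.* (4ℚ ^ B ℚ.* (fromℕ B ℚ.* fromℕ B))
    0≤K : 0ℚ ℚ.≤ K
    0≤K = *-≥0 (ℚ.nonNegative⁻¹ 2ℚ) (*-≥0 (0≤4^ B) (*-≥0 (fromℕ-≥0 B) (fromℕ-≥0 B)))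
    S = shrink (4ℚ ^ B) (0≤4^ B) (half>0 0<ε)
    P = within p (proj₁ (proj₂ S))
    T = ½^-small K 0≤K (half>0 (half>0 0<ε))
    L = (proj₁ P ∨ proj₁ T) ∨ (proj₁ (proj₂ F) ∨ proj₁ (proj₂ G))
    tail≤ : K ℚ.* ½^ L ℚ.≤ h
    tail≤ = proj₂ T L (∨ʳ {proj₁ P} (∨ˡ {proj₁ P ∨ proj₁ T} ℕ.≤-refl))
    f≤ : ∀ m → L ℕ.≤ m → ∣ f m ∣ ℚ.≤ fromℕ B
    f≤ m L≤m = ℚ.≤-trans (proj₂ (proj₂ F) m (∨ˡ (∨ʳ {proj₁ P ∨ proj₁ T} L≤m))) (fromℕ-mono (∨ˡ {proj₁ F} ℕ.≤-refl))
    g≤ : ∀ n → L ℕ.≤ n → ∣ g n ∣ ℚ.≤ fromℕ B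
    g≤ n L≤n = ℚ.≤-trans (proj₂ (proj₂ G) n (∨ʳ (∨ʳ {proj₁ P ∨ proj₁ T} L≤n))) (fromℕ-mono (∨ʳ {proj₁ F} ℕ.≤-refl))
    result : ∀ m n → L ℕ.≤ m → L ℕ.≤ n → ∣ approx m (f m) ℚ.- approx n (g n) ∣ ℚ.≤ ε
    result m n L≤m L≤n = begin
      ∣ approx m (f m) ℚ.- approx n (g n) ∣
        ≤⟨ ∣∣-triangle (approx m (f m)) (approx L (f m)) (approx n (g n)) ⟩
      ∣ approx m (f m) ℚ.- approx L (f m) ∣ ℚ.+ ∣ approx L (f m) ℚ.- approx n (g n) ∣
        ≤⟨ ℚ.+-mono-≤ (ℚ.≤-trans (approx-tail B (f≤ m L≤m) L≤m) tail≤)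
             (∣∣-triangle (approx L (f m)) (approx L (g n)) (approx n (g n))) ⟩
      h ℚ.+ (∣ approx L (f m) ℚ.- approx L (g n) ∣ ℚ.+ ∣ approx L (g n) ℚ.- approx n (g n) ∣)
        ≤⟨ ℚ.+-monoʳ-≤ h (ℚ.+-mono-≤
             (ℚ.≤-trans (approx-lipschitz B L (f≤ m L≤m) (g≤ n L≤n))
               (ℚ.≤-trans (*-monoˡ (4ℚ ^ B) (0≤4^ B) (proj₂ P m n (∨ˡ (∨ˡ L≤m)) (∨ˡ (∨ˡ L≤n)))) (proj₂ (proj₂ S))))
             (subst (ℚ._≤ h) (∣∣-comm (approx n (g n)) (approx L (g n)))
               (ℚ.≤-trans (approx-tail B (g≤ n L≤n) L≤n) tail≤))) ⟩
      h ℚ.+ (½ ℚ.* ε ℚ.+ h)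
        ≡⟨ solve 1 (λ ε → let h = con ½ :* (con ½ :* ε) in h :+ (con ½ :* ε :+ h) := ε) refl ε ⟩
      ε ∎
      where
      open +-*-Solver
      open ℚ.≤-Reasoning

  opaque
    exp-close : ∀ {f g} → Close f g → Close (λ k → approx k (f k)) (λ k → approx k (g k))
    exp-close p = mkClose λ 0<ε → ExpClose.L p 0<ε , ExpClose.result p 0<ε

open Closeness

infix  8 -_
infixl 7 _*_
infixl 6 _+_ _-_ _⊔_

fromℚ : ℚ → ℝ
fromℚ q = mkℝ (λ _ → q) (const-close q)

fromℕ : ℕ → ℝ
fromℕ n = fromℚ (Rational.fromℕ n)

0ℝ 1ℝ : ℝ
0ℝ = fromℚ 0ℚ
1ℝ = fromℚ 1ℚ

_+_ _*_ _⊔_ : ℝ → ℝ → ℝ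
x + y = mkℝ (λ n → seq x n ℚ.+ seq y n) (+-close (cauchy x) (cauchy y))
x * y = mkℝ (λ n → seq x n ℚ.* seq y n) (*-close (cauchy x) (cauchy y))
x ⊔ y = mkℝ (λ n → seq x n ℚ.⊔ seq y n) (⊔-close (cauchy x) (cauchy y))

-_ : ℝ → ℝ
-_ x = mkℝ (λ n → ℚ.- seq x n) (neg-close (cauchy x))

_-_ : ℝ → ℝ → ℝ
_-_ x y = x + - y

-- inverse 0ℚ = 0ℚ, but only finitely many terms of seq x can be 0ℚ.
recip : (x : ℝ) → 0ℝ < x → ℝ
recip x 0<x = mkℝ (λ n → inverse (seq x n)) (inverse-close (apart 0<x) (apart 0<x) (cauchy x))

-- exp x is the limit of (1 + x / 2ᵏ) ^ 2ᵏ, taken along the diagonal.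
exp : ℝ → ℝ
exp x = mkℝ (λ k → approx k (seq x k)) (exp-close (cauchy x))

<-trans : ∀ {x y z} → x < y → y < z → x < z
<-trans {x} {y} {z} (mk< (ε , 0<ε , N , x+ε≤y)) (mk< (η , 0<η , M , y+η≤z)) =
  mk< (ε , 0<ε , N ∨ M , λ n N≤n → ℚ.≤-trans (x+ε≤y n (∨ˡ N≤n))
    (ℚ.≤-trans (Rational.≤-by η (ℚ.<⇒≤ 0<η) refl) (y+η≤z n (∨ʳ N≤n))))

<-irrefl : ∀ {x} → ¬ x < x
<-irrefl {x} (mk< (ε , 0<ε , N , x+ε≤x)) =
  ℚ.<-irrefl refl (ℚ.<-≤-trans (Rational.<-by ε 0<ε refl) (x+ε≤x N ℕ.≤-refl))

<-compare : ∀ {x y} → x < y → ∀ z → x < z ⊎ z < y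
<-compare {x} {y} (mk< (ε , 0<ε , N , x+ε≤y)) z = decide (ℚ.≤-total (seq x M ℚ.+ 2ℚ ℚ.* h) (seq z M))
  where
  open Rational
  open +-*-Solver
  h : ℚ
  h = ½ ℚ.* (½ ℚ.* ε)
  0<h : 0ℚ ℚ.< h
  0<h = half>0 (half>0 0<ε)
  X = within (cauchy x) (half>0 0<h)
  Y = within (cauchy y) (half>0 0<h)
  Z = within (cauchy z) (half>0 0<h)
  M : ℕ
  M = N ∨ proj₁ X ∨ proj₁ Y ∨ proj₁ Z
  M≤M : M ℕ.≤ M
  M≤M = ℕ.≤-refl
  swap : ∀ {a b} → ∣ a ℚ.- b ∣ ℚ.≤ ½ ℚ.* h → ∣ b ℚ.- a ∣ ℚ.≤ ½ ℚ.* h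
  swap {a} {b} = subst (ℚ._≤ ½ ℚ.* h) (∣∣-comm a b)
  decide : seq x M ℚ.+ 2ℚ ℚ.* h ℚ.≤ seq z M ⊎ seq z M ℚ.≤ seq x M ℚ.+ 2ℚ ℚ.* h → x < z ⊎ z < y
  decide (inj₁ x≤z) = inj₁ (mk< (h , 0<h , M , λ n M≤n → compare-lower {seq x M} {seq x n} {seq z M} {seq z n} {h}
    (proj₂ X n M (∨ʳ (∨ˡ (∨ˡ M≤n))) (∨ʳ (∨ˡ (∨ˡ M≤M))))
    (proj₂ Z n M (∨ʳ M≤n) (∨ʳ M≤M)) x≤z))
  decide (inj₂ z≤x) = inj₂ (mk< (h , 0<h , M , λ n M≤n → compare-lower {seq z M} {seq z n} {seq y M} {seq y n} {h}
    (proj₂ Z n M (∨ʳ M≤n) (∨ʳ M≤M))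
    (proj₂ Y n M (∨ʳ (∨ˡ M≤n)) (∨ʳ (∨ˡ M≤M)))
    (ℚ.≤-trans (ℚ.+-monoˡ-≤ (2ℚ ℚ.* h) z≤x) (subst (ℚ._≤ seq y M)
      (solve 2 (λ x ε → let h = con ½ :* (con ½ :* ε) in x :+ ε := x :+ con 2ℚ :* h :+ con 2ℚ :* h) refl (seq x M) ε)
      (x+ε≤y M (∨ˡ (∨ˡ (∨ˡ M≤M))))))))

0<1 : 0ℝ < 1ℝ
0<1 = mk< (1ℚ , Rational.0<1 , 0 , λ _ _ → ℚ.≤-refl)

<⇒0<- : ∀ {x y} → x < y → 0ℝ < y - x
<⇒0<- {x} {y} (mk< (ε , 0<ε , N , x+ε≤y)) = mk< (ε , 0<ε , N , λ n N≤n →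
  Rational.≤-by _ (Rational.diff≥0 (x+ε≤y n N≤n))
    (solve 3 (λ x y ε → con 0ℚ :+ ε :+ (y :- (x :+ ε)) := y :- x) refl (seq x n) (seq y n) ε))
  where open +-*-Solver

0<1-⇒<1 : ∀ {x} → 0ℝ < x → 1ℝ - x < 1ℝ
0<1-⇒<1 {x} (mk< (ε , 0<ε , N , ε≤x)) = mk< (ε , 0<ε , N , λ n N≤n →
  Rational.≤-by _ (Rational.diff≥0 (ε≤x n N≤n))
    (solve 2 (λ x ε → con 1ℚ :- x :+ ε :+ (x :- (con 0ℚ :+ ε)) := con 1ℚ) refl (seq x n) ε))
  where open +-*-Solver

*-positive : ∀ {x y} → 0ℝ < x → 0ℝ < y → 0ℝ < x * y
*-positive {x} {y} (mk< (ε , 0<ε , N , ε≤x)) (mk< (η , 0<η , M , η≤y)) =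
  mk< (ε ℚ.* η , Rational.*->0 0<ε 0<η , N ∨ M , λ n N≤n → subst (ℚ._≤ seq x n ℚ.* seq y n)
    (sym (ℚ.+-identityˡ (ε ℚ.* η)))
    (Rational.*-mono (ℚ.<⇒≤ 0<ε) (ℚ.≤-trans (ℚ.<⇒≤ 0<η) (η≤ n (∨ʳ N≤n)))
      (subst (ℚ._≤ seq x n) (ℚ.+-identityˡ ε) (ε≤x n (∨ˡ N≤n))) (η≤ n (∨ʳ N≤n))))
  where
  η≤ : ∀ n → M ℕ.≤ n → η ℚ.≤ seq y n
  η≤ n M≤n = subst (ℚ._≤ seq y n) (ℚ.+-identityˡ η) (η≤y n M≤n)

recip-positive : ∀ {x} (0<x : 0ℝ < x) → 0ℝ < recip x 0<x
recip-positive {x} 0<x@(mk< (ε , 0<ε , N , ε≤x)) = mk< (inverse S , inverse>0 0<S , N ∨ proj₁ (proj₂ B) , λ n N≤n →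
    subst (ℚ._≤ inverse (seq x n)) (sym (ℚ.+-identityˡ (inverse S)))
      (inverse-anti (ℚ.<-≤-trans 0<ε (subst (ℚ._≤ seq x n) (ℚ.+-identityˡ ε) (ε≤x n (∨ˡ N≤n))))
        (ℚ.≤-trans (a≤∣a∣ (seq x n)) (ℚ.≤-trans (proj₂ (proj₂ B) n (∨ʳ N≤n)) (≤-by 1ℚ 0≤1 (ℚ.+-comm (Rational.fromℕ (proj₁ B)) 1ℚ))))))
  where
  open Rational hiding (0<1)
  B = bounded (cauchy x)
  S : ℚ
  S = Rational.fromℕ (suc (proj₁ B))
  0<S : 0ℚ ℚ.< S
  0<S = +->0 Rational.0<1 (fromℕ-≥0 (proj₁ B))

recip->1 : ∀ {x} (0<x : 0ℝ < x) → x < 1ℝ → 1ℝ < recip x 0<x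
recip->1 {x} 0<x@(mk< (ε , 0<ε , N , ε≤x)) (mk< (η , 0<η , M , x+η≤1)) = mk< (η , 0<η , N ∨ M , λ n N≤n → let
    x>0 : 0ℚ ℚ.< seq x n
    x>0 = ℚ.<-≤-trans 0<ε (subst (ℚ._≤ seq x n) (ℚ.+-identityˡ ε) (ε≤x n (∨ˡ N≤n)))
    d≥0 : 0ℚ ℚ.≤ 1ℚ ℚ.- (seq x n ℚ.+ η)
    d≥0 = diff≥0 (x+η≤1 n (∨ʳ N≤n))
  in cancel-≤ (seq x n) x>0 (ℚ.≤-trans
    (≤-by (1ℚ ℚ.- (seq x n ℚ.+ η) ℚ.+ η ℚ.* (1ℚ ℚ.- (seq x n ℚ.+ η) ℚ.+ η))
      (+-≥0 d≥0 (*-≥0 (ℚ.<⇒≤ 0<η) (+-≥0 d≥0 (ℚ.<⇒≤ 0<η))))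
      (solve 2 (λ x η → (con 1ℚ :+ η) :* x :+ (con 1ℚ :- (x :+ η) :+ η :* (con 1ℚ :- (x :+ η) :+ η)) := con 1ℚ) refl (seq x n) η))
    (ℚ.≤-reflexive (sym (inverse-*ˡ x>0)))))
  where
  open Rational
  open +-*-Solver

-- ln y is the number with exp (ln y) ≈ y. It is trapped between rationals by
-- repeatedly discarding an outer third of an interval [lo , hi] with
-- exp lo < y < exp hi.

record Bracket (y : ℝ) : Set where
  field
    lo hi : ℚ
    lo<hi : lo ℚ.< hi
    lower : exp (fromℚ lo) < y
    upper : y < exp (fromℚ hi)

  width : ℚ
  width = hi ℚ.- lo

module _ {y : ℝ} where
  open Bracket
  open Rational using (approx-<; approx-large; approx-small; third; third-<; third-≥; third-≤; third-width; third-width′)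

  module Initial {ε} (0<ε : 0ℚ ℚ.< ε) (N : ℕ) (ε≤y : ∀ n → N ℕ.≤ n → 0ℚ ℚ.+ ε ℚ.≤ seq y n) where
    open ℚ.≤-Reasoning
    S : ∃ λ A → ∃ λ N → ∀ k → N ℕ.≤ k → approx k (ℚ.- Rational.fromℕ A) ℚ.≤ ½ ℚ.* ε
    S = approx-small (Rational.half>0 0<ε)
    T : ∃ λ B → ∃ λ N → ∀ n → N ℕ.≤ n → ∣ seq y n ∣ ℚ.≤ Rational.fromℕ B
    T = bounded (cauchy y)
    A B : ℕ
    A = proj₁ S
    B = proj₁ T
    0<1+B : 0ℚ ℚ.< Rational.fromℕ (suc B)
    0<1+B = Rational.+->0 Rational.0<1 (Rational.fromℕ-≥0 B)
    lower-bound : ∀ k → N ∨ proj₁ (proj₂ S) ℕ.≤ k → approx k (ℚ.- Rational.fromℕ A) ℚ.+ ½ ℚ.* ε ℚ.≤ seq y k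
    lower-bound k N≤k = begin
      approx k (ℚ.- Rational.fromℕ A) ℚ.+ ½ ℚ.* ε   ≤⟨ ℚ.+-monoˡ-≤ (½ ℚ.* ε) (proj₂ (proj₂ S) k (∨ʳ N≤k)) ⟩
      ½ ℚ.* ε ℚ.+ ½ ℚ.* ε                           ≡⟨ Rational.halves ε ⟩
      ε                                             ≡⟨ ℚ.+-identityˡ ε ⟨
      0ℚ ℚ.+ ε                                      ≤⟨ ε≤y k (∨ˡ N≤k) ⟩
      seq y k                                       ∎
    b : ℚ
    b = Rational.fromℕ B
    upper-bound : ∀ k → proj₁ (proj₂ T) ℕ.≤ k → seq y k ℚ.+ 1ℚ ℚ.≤ approx k (Rational.fromℕ (suc B))
    upper-bound k N≤k = begin
      seq y k ℚ.+ 1ℚ                                ≤⟨ ℚ.+-monoˡ-≤ 1ℚ (Rational.a≤∣a∣ (seq y k)) ⟩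
      ∣ seq y k ∣ ℚ.+ 1ℚ                            ≤⟨ ℚ.+-monoˡ-≤ 1ℚ (proj₂ (proj₂ T) k N≤k) ⟩
      b ℚ.+ 1ℚ                                      ≡⟨ ℚ.+-comm b 1ℚ ⟩
      1ℚ ℚ.+ b                                      ≤⟨ Rational.≤-by {1ℚ ℚ.+ b} 1ℚ Rational.0≤1 (ℚ.+-comm (1ℚ ℚ.+ b) 1ℚ) ⟩
      1ℚ ℚ.+ (1ℚ ℚ.+ b)                             ≤⟨ approx-large (suc B) k ⟩
      approx k (Rational.fromℕ (suc B))             ∎

    initial : Bracket y
    initial = record
      { lo    = ℚ.- Rational.fromℕ A
      ; hi    = Rational.fromℕ (suc B)
      ; lo<hi = ℚ.≤-<-trans (ℚ.neg-antimono-≤ (Rational.fromℕ-≥0 A)) 0<1+B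
      ; lower = mk< (½ ℚ.* ε , Rational.half>0 0<ε , N ∨ proj₁ (proj₂ S) , lower-bound)
      ; upper = mk< (1ℚ , Rational.0<1 , proj₁ (proj₂ T) , upper-bound)
      }

  bracket : 0ℝ < y → Bracket y
  bracket (mk< (ε , 0<ε , N , ε≤y)) = Initial.initial 0<ε N ε≤y

  record Refined (b : Bracket y) : Set where
    field
      refined  : Bracket y
      lo-mono  : lo b ℚ.≤ lo refined
      hi-mono  : hi refined ℚ.≤ hi b
      narrowed : width refined ≡ (⅓ ℚ.+ ⅓) ℚ.* width b

  opaque
    refine : (b : Bracket y) → Refined b
    refine b = choose (<-compare {exp (fromℚ u)} {exp (fromℚ v)} (mk< (approx-< u<v)) y)
      where
      u v : ℚ
      u = third (lo b) (hi b)
      v = third (hi b) (lo b)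
      u<v : u ℚ.< v
      u<v = third-< (lo<hi b)
      choose : exp (fromℚ u) < y ⊎ y < exp (fromℚ v) → Refined b
      choose (inj₁ u<y) = record
        { refined  = record { lo = u ; hi = hi b ; lower = u<y ; upper = upper b
                            ; lo<hi = ℚ.<-≤-trans u<v (third-≤ (lo<hi b)) }
        ; lo-mono  = third-≥ (lo<hi b)
        ; hi-mono  = ℚ.≤-refl
        ; narrowed = third-width (lo b) (hi b)
        }
      choose (inj₂ y<v) = record
        { refined  = record { lo = lo b ; hi = v ; lower = lower b ; upper = y<v
                            ; lo<hi = ℚ.≤-<-trans (third-≥ (lo<hi b)) u<v }
        ; lo-mono  = ℚ.≤-refl
        ; hi-mono  = third-≤ (lo<hi b)
        ; narrowed = third-width′ (lo b) (hi b)
        }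

  open Refined

  module Brackets (0<y : 0ℝ < y) where
    open Rational using (_^_)

    brackets : ℕ → Bracket y
    brackets zero    = bracket 0<y
    brackets (suc k) = refined (refine (brackets k))

    widths : ∀ k → width (brackets k) ≡ width (brackets 0) ℚ.* (⅓ ℚ.+ ⅓) ^ k
    widths zero    = sym (ℚ.*-identityʳ (width (brackets 0)))
    widths (suc k) = trans (narrowed (refine (brackets k))) (trans (cong ((⅓ ℚ.+ ⅓) ℚ.*_) (widths k))
      (solve 3 (λ a w r → a :* (w :* r) := w :* (a :* r)) refl (⅓ ℚ.+ ⅓) (width (brackets 0)) ((⅓ ℚ.+ ⅓) ^ k)))
      where open +-*-Solver

    widths-small : ∀ {ε} → 0ℚ ℚ.< ε → ∃ λ N → ∀ k → N ℕ.≤ k → width (brackets k) ℚ.≤ ε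
    widths-small {ε} 0<ε = proj₁ S , λ k N≤k → subst (ℚ._≤ ε) (sym (widths k)) (proj₂ S k N≤k)
      where S = Rational.⅔^-small (width (brackets 0)) (ℚ.<⇒≤ (Rational.diff>0 (lo<hi (brackets 0)))) 0<ε

    los : ∀ {m n} → m ℕ.≤′ n → lo (brackets m) ℚ.≤ lo (brackets n)
    los ℕ.≤′-refl     = ℚ.≤-refl
    los (ℕ.≤′-step {n} p) = ℚ.≤-trans (los p) (lo-mono (refine (brackets n)))

    his : ∀ {m n} → m ℕ.≤′ n → hi (brackets n) ℚ.≤ hi (brackets m)
    his ℕ.≤′-refl     = ℚ.≤-refl
    his (ℕ.≤′-step {n} p) = ℚ.≤-trans (hi-mono (refine (brackets n))) (his p)

    opaque
      lo-close : Close (λ k → lo (brackets k)) (λ k → lo (brackets k))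
      lo-close = mkClose λ {ε} 0<ε → let
          W = widths-small 0<ε
          N = proj₁ W
          lo≤ : ∀ m n → N ℕ.≤ m → N ℕ.≤ n → lo (brackets m) ℚ.≤ lo (brackets n) ℚ.+ ε
          lo≤ m n N≤m N≤n = begin
            lo (brackets m)                              ≤⟨ ℚ.<⇒≤ (lo<hi (brackets m)) ⟩
            hi (brackets m)                              ≤⟨ his (ℕ.≤⇒≤′ N≤m) ⟩
            hi (brackets N)                              ≡⟨ solve 2 (λ l h → h := l :+ (h :- l)) refl (lo (brackets N)) (hi (brackets N)) ⟩
            lo (brackets N) ℚ.+ width (brackets N)       ≤⟨ ℚ.+-mono-≤ (los (ℕ.≤⇒≤′ N≤n)) (proj₂ W N ℕ.≤-refl) ⟩
            lo (brackets n) ℚ.+ ε                        ∎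
        in N , λ m n N≤m N≤n → Rational.≤⇒near (lo≤ m n N≤m N≤n) (lo≤ n m N≤n N≤m)
        where
        open ℚ.≤-Reasoning
        open +-*-Solver

infix 3 _,⁺_

record ℝ⁺ : Set where
  constructor _,⁺_
  field
    real     : ℝ
    positive : 0ℝ < real

open ℝ⁺ public

ln : ℝ⁺ → ℝ
ln (y ,⁺ 0<y) = mkℝ (λ k → Bracket.lo (brackets k)) lo-close
  where open Brackets 0<y

ln-positive : ∀ y → 1ℝ < real y → 0ℝ < ln y
ln-positive (y ,⁺ 0<y) (mk< (ε , 0<ε , N , 1+ε≤y)) = mk< (½ ℚ.* c , Rational.half>0 0<c , proj₁ W , λ k W≤k → let
    open Bracket (brackets k)
  in Rational.≤-by ((hi ℚ.- c) ℚ.+ (½ ℚ.* c ℚ.- width))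
    (Rational.+-≥0 (Rational.diff≥0 (c≤hi (brackets k))) (Rational.diff≥0 (proj₂ W k W≤k)))
    (solve 3 (λ l h c → con 0ℚ :+ con ½ :* c :+ ((h :- c) :+ (con ½ :* c :- (h :- l))) := l) refl lo hi c))
  where
  open Brackets 0<y
  open +-*-Solver
  C : ∃ λ c → 0ℚ ℚ.< c × (∀ k → approx k c ℚ.≤ 1ℚ ℚ.+ ½ ℚ.* ε)
  C = Rational.approx-near-1 (Rational.half>0 0<ε)
  c : ℚ
  c = proj₁ C
  0<c : 0ℚ ℚ.< c
  0<c = proj₁ (proj₂ C)
  W = widths-small (Rational.half>0 0<c)
  exp-c<y : exp (fromℚ c) < y
  exp-c<y = mk< (½ ℚ.* ε , Rational.half>0 0<ε , N , λ k N≤k → ℚ.≤-trans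
    (ℚ.+-monoˡ-≤ (½ ℚ.* ε) (proj₂ (proj₂ C) k))
    (subst (ℚ._≤ seq y k) (solve 1 (λ ε → con 1ℚ :+ ε := con 1ℚ :+ con ½ :* ε :+ con ½ :* ε) refl ε) (1+ε≤y k N≤k)))
  c≤hi : (b : Bracket y) → c ℚ.≤ Bracket.hi b
  c≤hi b = ℚ.≮⇒≥ λ hi<c → <-irrefl (<-trans (<-trans exp-c<y (Bracket.upper b)) (mk< (Rational.approx-< hi<c)))

infixl 7 _/_ _/⁺_

_/_ : ℝ → ℝ⁺ → ℝ
x / (y ,⁺ 0<y) = x * recip y 0<y

_/⁺_ : ℝ⁺ → ℝ⁺ → ℝ⁺
x /⁺ y = real x / y ,⁺ *-positive (positive x) (recip-positive (positive y))

1⁺ : ℝ⁺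
1⁺ = 1ℝ ,⁺ 0<1

fromℕ⁺ : (n : ℕ) .{{_ : ℕ.NonZero n}} → ℝ⁺
fromℕ⁺ n = fromℕ n ,⁺ mk< (1ℚ , Rational.0<1 , 0 , λ _ _ → Rational.fromℕ-mono (ℕ.>-nonZero⁻¹ n))

infix 3 _,>1_

record ℝ>1 : Set where
  constructor _,>1_
  field
    base : ℝ
    >1   : 1ℝ < base

  base⁺ : ℝ⁺
  base⁺ = base ,⁺ <-trans 0<1 >1

  base-1⁺ : ℝ⁺
  base-1⁺ = base - 1ℝ ,⁺ <⇒0<- >1

open ℝ>1 public

log : ℝ>1 → ℝ⁺ → ℝ
log q x = ln x / (ln (base⁺ q) ,⁺ ln-positive (base⁺ q) (>1 q))

record 𝕀 : Set where
  field
    value : ℝ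
    0<    : 0ℝ < value
    <1    : value < 1ℝ

  value⁺ : ℝ⁺
  value⁺ = value ,⁺ 0<

  1-value⁺ : ℝ⁺
  1-value⁺ = 1ℝ - value ,⁺ <⇒0<- <1

open 𝕀 public

KL : 𝕀 → 𝕀 → ℝ
KL lam eta = value lam * ln (value⁺ lam /⁺ value⁺ eta) + (1ℝ - value lam) * ln (1-value⁺ lam /⁺ 1-value⁺ eta)

H : ℝ>1 → 𝕀 → ℝ
H q p = value p * log q (base-1⁺ q /⁺ value⁺ p) + (1ℝ - value p) * log q (1⁺ /⁺ 1-value⁺ p)

1/[1-_] : 𝕀 → ℝ>1
1/[1- p ] = recip (1ℝ - value p) (positive (1-value⁺ p)) ,>1 recip->1 (positive (1-value⁺ p)) (0<1-⇒<1 (0< p))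

∑ : ∀ {n} → Vector ℝ n → ℝ
∑ = foldr _+_ 0ℝ

maximum : ∀ {n} .{{_ : ℕ.NonZero n}} → Vector ℝ n → ℝ
maximum {1}           f = f zero
maximum {suc (suc n)} f = f zero ⊔ maximum (λ i → f (suc i))

record FiniteProbabilitySpace ℓ : Set (Level.suc ℓ) where
  field
    Ω           : Set ℓ
    size        : ℕ
    enumeration : Fin size ↔ Ω

  outcome : Fin size → Ω
  outcome = Inverse.to enumeration

  field
    weight     : Ω → ℝ
    weight≥0   : ∀ s → 0ℝ ≤ weight s
    weight-sum : ∑ (λ k → weight (outcome k)) ≈ 1ℝ

  𝔼 : (Ω → ℝ) → ℝ
  𝔼 f = ∑ (λ k → weight (outcome k) * f (outcome k))

open FiniteProbabilitySpace public using (Ω; 𝔼)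

-- A finite multiset is listed, with repetitions, by a vector; under the uniform
-- distribution every entry of the list has weight 1 / m.

𝔼U : ∀ {ℓ} {A : Set ℓ} {m} .{{_ : ℕ.NonZero m}} → Vector A m → (A → ℝ) → ℝ
𝔼U {m = m} S f = ∑ (λ k → f (S k)) / fromℕ⁺ m

bit : Fin 2 → ℝ
bit b = fromℕ (toℕ b)

-- Indices start at 0, so the index sets [N′] and (N′ , N] are {i | toℕ i < N′}
-- and {j | N′ ≤ toℕ j}.

GoodSample : ∀ {ℓ} {A : Set ℓ} {N} → (Fin N → A → Fin 2) → ℕ → (Fin N → 𝕀) →
             (m : ℕ) → .{{ℕ.NonZero m}} → Set ℓ
GoodSample {A = A} X N′ lam m = Σ (Vector A m) λ S →
  (∀ i → toℕ i ℕ.< N′ → value (lam i) ≤ 𝔼U S (λ s → bit (X i s))) ×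
  (∀ j → N′ ℕ.≤ toℕ j → 𝔼U S (λ s → bit (X j s)) ≤ value (lam j))

{-# OPTIONS --safe #-}
module Submission where

-- Let g i s be the logarithm of the likelihood ratio of the outcome X i s under
-- the parameters lam i and p i. The hypotheses on the expectations imply
-- that exp (g i) has mean at most 1, so the points s₁, …, sₘ can be chosen one
-- after another such that the sum over i of
--   exp (- m D(lam i ‖ p i) + g i s₁ + … + g i sₘ)
-- never grows past P₀. The i-th exponent equals
-- (ln (lam i / p i) - ln ((1 - lam i) / (1 - p i))) (X i s₁ + … + X i sₘ - m lam i),
-- which is negative as soon as the i-th summand is below 1, and its first factor
-- has the sign of lam i - p i.
--
-- Real comparison is undecidable, so a point of average value cannot be found,
-- only one below a bound strictly larger than the average. The choice therefore
-- keeps the sum below a constant slightly larger than P₀, fixed in advance so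
-- that every single summand still ends up below 1.

open import Defs
open import Algebra.Bundles using (CommutativeRing)
import Algebra.Properties.Semiring.Sum as SemiringSum
import Algebra.Solver.Ring as RingSolver
open import Algebra.Solver.Ring.AlmostCommutativeRing using (fromCommutativeRing; _-Raw-AlmostCommutative⟶_)
open import Data.Fin.Base using (Fin; zero; suc; toℕ)
open import Data.Maybe.Base using (Maybe; just; nothing)
open import Data.Nat.Base as ℕ using (ℕ; zero; suc)
import Data.Nat.Properties as ℕ
open import Data.Product.Base using (Σ; ∃; _×_; _,_; proj₁; proj₂)
open import Data.Rational.Base as ℚ using (ℚ; 0ℚ; 1ℚ; ½; ∣_∣)
import Data.Rational.Properties as ℚ
open import Data.Rational.Solver using (module +-*-Solver)
open import Data.Sum.Base using (_⊎_; inj₁; inj₂; [_,_]′)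
open import Data.Vec.Functional using (Vector; []; _∷_)
open import Relation.Binary.Definitions using (Asymmetric; _Respects₂_)
open import Relation.Binary.PropositionalEquality as ≡ using (_≡_; subst; cong)
import Relation.Binary.Reasoning.Base.Triple as TripleReasoning
open import Relation.Binary.Structures using (IsEquivalence; IsPreorder)
open import Relation.Nullary using (¬_; yes; no; contradiction)

open Closeness

-- Equality of reals and their ring structure.

≗⇒≈ : ∀ {x y} → (∀ n → seq x n ≡ seq y n) → x ≈ y
≗⇒≈ {x} {y} p = mk≈ (mkClose λ {ε} 0<ε → let C = within (cauchy x) 0<ε in proj₁ C , λ m n N≤m N≤n →
  subst (λ t → ∣ seq x m ℚ.- t ∣ ℚ.≤ ε) (p n) (proj₂ C m n N≤m N≤n))

≈-refl : ∀ {x} → x ≈ x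
≈-refl {x} = mk≈ (cauchy x)

≈-sym : ∀ {x y} → x ≈ y → y ≈ x
≈-sym p = mk≈ (close-sym (close p))

≈-trans : ∀ {x y z} → x ≈ y → y ≈ z → x ≈ z
≈-trans {x} {y} {z} p q = mk≈ (mkClose λ {ε} 0<ε → let
    P = within (close p) (Rational.half>0 0<ε)
    Q = within (close q) (Rational.half>0 0<ε)
    k = proj₁ P ∨ proj₁ Q
  in k , λ m n N≤m N≤n → subst (∣ seq x m ℚ.- seq z n ∣ ℚ.≤_) (Rational.halves ε)
    (ℚ.≤-trans (Rational.∣∣-triangle (seq x m) (seq y k) (seq z n))
      (ℚ.+-mono-≤ (proj₂ P m k (∨ˡ N≤m) (∨ˡ {proj₁ P} ℕ.≤-refl)) (proj₂ Q k n (∨ʳ {proj₁ P} ℕ.≤-refl) (∨ʳ N≤n)))))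

≈-isEquivalence : IsEquivalence _≈_
≈-isEquivalence = record { refl = ≈-refl ; sym = ≈-sym ; trans = ≈-trans }

+-cong : ∀ {x x′ y y′} → x ≈ x′ → y ≈ y′ → x + y ≈ x′ + y′
+-cong p q = mk≈ (+-close (close p) (close q))

*-cong : ∀ {x x′ y y′} → x ≈ x′ → y ≈ y′ → x * y ≈ x′ * y′
*-cong p q = mk≈ (*-close (close p) (close q))

*-congˡ : ∀ x {y z} → y ≈ z → x * y ≈ x * z
*-congˡ x = *-cong (≈-refl {x})

*-congʳ : ∀ x {y z} → y ≈ z → y * x ≈ z * x
*-congʳ x p = *-cong p (≈-refl {x})

-‿cong : ∀ {x y} → x ≈ y → - x ≈ - y
-‿cong p = mk≈ (neg-close (close p))

-- The operations act termwise, so the algebraic laws are inherited from the rationals at each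
-- index.
ℝ-commutativeRing : CommutativeRing _ _
ℝ-commutativeRing = record
  { Carrier = ℝ ; _≈_ = _≈_ ; _+_ = _+_ ; _*_ = _*_ ; -_ = -_ ; 0# = 0ℝ ; 1# = 1ℝ
  ; isCommutativeRing = record
    { isRing = record
      { +-isAbelianGroup = record
        { isGroup = record
          { isMonoid = record
            { isSemigroup = record
              { isMagma = record { isEquivalence = ≈-isEquivalence ; ∙-cong = +-cong }
              ; assoc = λ x y z → ≗⇒≈ λ n → ℚ.+-assoc (seq x n) (seq y n) (seq z n)
              }
            ; identity = (λ x → ≗⇒≈ λ n → ℚ.+-identityˡ (seq x n)) , (λ x → ≗⇒≈ λ n → ℚ.+-identityʳ (seq x n))
            }
          ; inverse = (λ x → ≗⇒≈ λ n → ℚ.+-inverseˡ (seq x n)) , (λ x → ≗⇒≈ λ n → ℚ.+-inverseʳ (seq x n))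
          ; ⁻¹-cong = -‿cong
          }
        ; comm = λ x y → ≗⇒≈ λ n → ℚ.+-comm (seq x n) (seq y n)
        }
      ; *-cong = *-cong
      ; *-assoc = λ x y z → ≗⇒≈ λ n → ℚ.*-assoc (seq x n) (seq y n) (seq z n)
      ; *-identity = (λ x → ≗⇒≈ λ n → ℚ.*-identityˡ (seq x n)) , (λ x → ≗⇒≈ λ n → ℚ.*-identityʳ (seq x n))
      ; distrib = (λ x y z → ≗⇒≈ λ n → ℚ.*-distribˡ-+ (seq x n) (seq y n) (seq z n))
                , (λ x y z → ≗⇒≈ λ n → ℚ.*-distribʳ-+ (seq x n) (seq y n) (seq z n))
      }
    ; *-comm = λ x y → ≗⇒≈ λ n → ℚ.*-comm (seq x n) (seq y n)
    }
  }

fromℚ-morphism : ℚ.+-*-rawRing -Raw-AlmostCommutative⟶ fromCommutativeRing ℝ-commutativeRing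
fromℚ-morphism = record
  { ⟦_⟧    = fromℚ
  ; +-homo = λ _ _ → ≗⇒≈ λ _ → ≡.refl
  ; *-homo = λ _ _ → ≗⇒≈ λ _ → ≡.refl
  ; -‿homo = λ _ → ≗⇒≈ λ _ → ≡.refl
  ; 0-homo = ≈-refl
  ; 1-homo = ≈-refl
  }

-- Equality of rational coefficients is decidable even though equality of reals is not; this lets
-- the ring solver normalise expressions with rational constants.
fromℚ-≟ : ∀ p q → Maybe (fromℚ p ≈ fromℚ q)
fromℚ-≟ p q with p ℚ.≟ q
... | yes ≡.refl = just ≈-refl
... | no _       = nothing

-- The order on the reals.

≈⇒≤ : ∀ {x y} → x ≈ y → x ≤ y
≈⇒≤ {x} {y} p = mk≤ λ 0<ε → let P = within (close p) 0<ε in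
  proj₁ P , λ n N≤n → Rational.near⇒≤ {seq x n} {seq y n} (proj₂ P n n N≤n N≤n)

≤-refl : ∀ {x} → x ≤ x
≤-refl = ≈⇒≤ ≈-refl

≤-trans : ∀ {x y z} → x ≤ y → y ≤ z → x ≤ z
≤-trans {x} {y} {z} (mk≤ p) (mk≤ q) = mk≤ λ {ε} 0<ε → let
    P = p (Rational.half>0 0<ε)
    Q = q (Rational.half>0 0<ε)
  in proj₁ P ∨ proj₁ Q , λ n N≤n → ℚ.≤-trans (proj₂ P n (∨ˡ N≤n)) (ℚ.≤-trans
    (ℚ.+-monoˡ-≤ (½ ℚ.* ε) (proj₂ Q n (∨ʳ N≤n)))
    (ℚ.≤-reflexive (≡.trans (ℚ.+-assoc (seq z n) _ _) (cong (seq z n ℚ.+_) (Rational.halves ε)))))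

<⇒≤ : ∀ {x y} → x < y → x ≤ y
<⇒≤ {x} {y} (mk< (δ , 0<δ , N , p)) = mk≤ λ {ε} 0<ε → N , λ n N≤n →
  ℚ.≤-trans (Rational.≤-by δ (ℚ.<⇒≤ 0<δ) ≡.refl) (ℚ.≤-trans (p n N≤n) (Rational.≤-by ε (ℚ.<⇒≤ 0<ε) ≡.refl))

≤-<-trans : ∀ {x y z} → x ≤ y → y < z → x < z
≤-<-trans {x} {y} {z} (mk≤ p) (mk< (δ , 0<δ , N , q)) = mk< (½ ℚ.* δ , Rational.half>0 0<δ , proj₁ P ∨ N ,
  λ n N≤n → ℚ.≤-trans (ℚ.+-monoˡ-≤ (½ ℚ.* δ) (proj₂ P n (∨ˡ N≤n)))
    (ℚ.≤-trans (ℚ.≤-reflexive (≡.trans (ℚ.+-assoc (seq y n) _ _) (cong (seq y n ℚ.+_) (Rational.halves δ))))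
      (q n (∨ʳ N≤n))))
  where P = p (Rational.half>0 0<δ)

<-≤-trans : ∀ {x y z} → x < y → y ≤ z → x < z
<-≤-trans {x} {y} {z} (mk< (δ , 0<δ , N , p)) (mk≤ q) = mk< (½ ℚ.* δ , Rational.half>0 0<δ , N ∨ proj₁ Q ,
  λ n N≤n → Rational.≤-by ((seq y n ℚ.- (seq x n ℚ.+ δ)) ℚ.+ (seq z n ℚ.+ ½ ℚ.* δ ℚ.- seq y n))
    (Rational.+-≥0 (Rational.diff≥0 (p n (∨ˡ N≤n))) (Rational.diff≥0 (proj₂ Q n (∨ʳ N≤n))))
    (solve 4 (λ x y z δ → x :+ con ½ :* δ :+ ((y :- (x :+ δ)) :+ (z :+ con ½ :* δ :- y)) := z) ≡.refl (seq x n) (seq y n) (seq z n) δ))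
  where
  Q = q (Rational.half>0 0<δ)
  open +-*-Solver

-- For each rational `ε`, `x` can be located against the gap between `y` and `y + ε`, and only
-- `x < y + ε` survives. Weak inequalities can therefore be proved by contradiction.
≮⇒≥ : ∀ {x y} → ¬ y < x → x ≤ y
≮⇒≥ {x} {y} y≮x = mk≤ λ {ε} 0<ε → decide (<-compare {y} {y + fromℚ ε} (mk< (ε , 0<ε , 0 , λ _ _ → ℚ.≤-refl)) x)
  where
  decide : ∀ {ε} → y < x ⊎ x < y + fromℚ ε → ∃ λ N → ∀ n → N ℕ.≤ n → seq x n ℚ.≤ seq y n ℚ.+ ε
  decide (inj₁ y<x)                    = contradiction y<x y≮x
  decide (inj₂ (mk< (δ , 0<δ , N , p))) = N , λ n N≤n → ℚ.≤-trans (Rational.≤-by δ (ℚ.<⇒≤ 0<δ) ≡.refl) (p n N≤n)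

≤⇒≯ : ∀ {x y} → x ≤ y → ¬ y < x
≤⇒≯ x≤y y<x = <-irrefl (≤-<-trans x≤y y<x)

≤-antisym : ∀ {x y} → x ≤ y → y ≤ x → x ≈ y
≤-antisym {x} {y} (mk≤ p) (mk≤ q) = mk≈ (mkClose λ {ε} 0<ε → let
    P = p (Rational.half>0 0<ε)
    Q = q (Rational.half>0 0<ε)
    C = within (cauchy y) (Rational.half>0 0<ε)
  in (proj₁ P ∨ proj₁ Q) ∨ proj₁ C , λ m n N≤m N≤n → subst (∣ seq x m ℚ.- seq y n ∣ ℚ.≤_) (Rational.halves ε)
    (ℚ.≤-trans (Rational.∣∣-triangle (seq x m) (seq y m) (seq y n)) (ℚ.+-mono-≤
      (Rational.≤⇒near (proj₂ P m (∨ˡ (∨ˡ N≤m))) (proj₂ Q m (∨ʳ (∨ˡ N≤m))))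
      (proj₂ C m n (∨ʳ N≤m) (∨ʳ N≤n)))))

<-asym : Asymmetric _<_
<-asym x<y y<x = <-irrefl (<-trans x<y y<x)

<-resp-≈ : _<_ Respects₂ _≈_
<-resp-≈ = (λ y≈z x<y → <-≤-trans x<y (≈⇒≤ y≈z)) , (λ x≈y x<z → ≤-<-trans (≈⇒≤ (≈-sym x≈y)) x<z)

≤-isPreorder : IsPreorder _≈_ _≤_
≤-isPreorder = record { isEquivalence = ≈-isEquivalence ; reflexive = ≈⇒≤ ; trans = ≤-trans }

open TripleReasoning ≤-isPreorder <-asym <-trans <-resp-≈ <⇒≤ <-≤-trans ≤-<-trans
  hiding (step-≡; step-≡-∣; step-≡-⟩; step-≡-⟨; step-≡˘)

+-mono-≤ : ∀ {x y u v} → x ≤ y → u ≤ v → x + u ≤ y + v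
+-mono-≤ {x} {y} {u} {v} (mk≤ p) (mk≤ q) = mk≤ λ {ε} 0<ε → let
    P = p (Rational.half>0 0<ε)
    Q = q (Rational.half>0 0<ε)
  in proj₁ P ∨ proj₁ Q , λ n N≤n → ℚ.≤-trans (ℚ.+-mono-≤ (proj₂ P n (∨ˡ N≤n)) (proj₂ Q n (∨ʳ N≤n)))
    (ℚ.≤-reflexive (solve 3 (λ y v ε → (y :+ con ½ :* ε) :+ (v :+ con ½ :* ε) := (y :+ v) :+ ε) ≡.refl (seq y n) (seq v n) ε))
  where open +-*-Solver

+-monoʳ-< : ∀ x {y z} → y < z → x + y < x + z
+-monoʳ-< x {y} {z} (mk< (δ , 0<δ , N , p)) = mk< (δ , 0<δ , N , λ n N≤n →
  subst (ℚ._≤ seq x n ℚ.+ seq z n) (≡.sym (ℚ.+-assoc (seq x n) (seq y n) δ)) (ℚ.+-monoʳ-≤ (seq x n) (p n N≤n)))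

-- Arithmetic of inequalities, reciprocals and quotients.

module ℝ-Solver = RingSolver ℚ.+-*-rawRing (fromCommutativeRing ℝ-commutativeRing) fromℚ-morphism fromℚ-≟

open ℝ-Solver using (solve; _:=_; _:+_; _:*_; _:-_; :-_; con)
open CommutativeRing ℝ-commutativeRing using (+-identityˡ; +-identityʳ; *-identityˡ; *-identityʳ; *-comm; zeroˡ)

≤-by : ∀ {x y} z → 0ℝ ≤ z → x + z ≈ y → x ≤ y
≤-by {x} {y} z 0≤z x+z≈y = begin
  x        ≈⟨ +-identityʳ x ⟨
  x + 0ℝ   ≤⟨ +-mono-≤ (≤-refl {x}) 0≤z ⟩
  x + z    ≈⟨ x+z≈y ⟩
  y        ∎

<-by : ∀ {x y} z → 0ℝ < z → x + z ≈ y → x < y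
<-by {x} {y} z 0<z x+z≈y = begin-strict
  x        ≈⟨ +-identityʳ x ⟨
  x + 0ℝ   <⟨ +-monoʳ-< x 0<z ⟩
  x + z    ≈⟨ x+z≈y ⟩
  y        ∎

diff≥0 : ∀ {x y} → x ≤ y → 0ℝ ≤ y - x
diff≥0 {x} {y} x≤y = begin
  0ℝ      ≈⟨ solve 1 (λ x → con 0ℚ := x :- x) ≈-refl x ⟩
  x - x   ≤⟨ +-mono-≤ x≤y (≤-refl { - x}) ⟩
  y - x   ∎

+-≥0 : ∀ {x y} → 0ℝ ≤ x → 0ℝ ≤ y → 0ℝ ≤ x + y
+-≥0 {x} {y} 0≤x 0≤y = ≤-trans 0≤x (≤-by y 0≤y ≈-refl)

+->0 : ∀ {x y} → 0ℝ < x → 0ℝ ≤ y → 0ℝ < x + y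
+->0 {x} {y} 0<x 0≤y = <-≤-trans 0<x (≤-by y 0≤y ≈-refl)

neg>0 : ∀ {x} → x < 0ℝ → 0ℝ < - x
neg>0 {x} x<0 = <-≤-trans (<⇒0<- x<0) (≈⇒≤ (+-identityˡ (- x)))

neg<0 : ∀ {x} → 0ℝ < x → - x < 0ℝ
neg<0 {x} 0<x = <-by x 0<x (solve 1 (λ x → :- x :+ x := con 0ℚ) ≈-refl x)

-- Once the terms of `x` are at least `ε`, the termwise product is exactly 1; only earlier terms can
-- meet the default value of `inverse`.
recip-*ˡ : ∀ x (0<x : 0ℝ < x) → recip x 0<x * x ≈ 1ℝ
recip-*ˡ x 0<x@(mk< (ε , 0<ε , N , ε≤x)) = mk≈ (mkClose λ {η} 0<η → N , λ m n N≤m _ →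
  subst (λ t → ∣ t ℚ.- 1ℚ ∣ ℚ.≤ η)
    (≡.sym (Rational.inverse-*ˡ (ℚ.<-≤-trans 0<ε (subst (ℚ._≤ seq x m) (ℚ.+-identityˡ ε) (ε≤x m N≤m)))))
    (ℚ.<⇒≤ 0<η))

*-cancel->0 : ∀ {x y} → 0ℝ < x → 0ℝ < x * y → 0ℝ < y
*-cancel->0 {x} {y} 0<x 0<xy = begin-strict
  0ℝ                      <⟨ *-positive (recip-positive 0<x) 0<xy ⟩
  recip x 0<x * (x * y)   ≈⟨ solve 3 (λ r x y → r :* (x :* y) := r :* x :* y) ≈-refl (recip x 0<x) x y ⟩
  recip x 0<x * x * y     ≈⟨ *-congʳ y (recip-*ˡ x 0<x) ⟩
  1ℝ * y                  ≈⟨ *-identityˡ y ⟩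
  y                       ∎

-- The strict sign of `x` allows division: a negative product would make `- y` positive.
*-≥0 : ∀ {x y} → 0ℝ < x → 0ℝ ≤ y → 0ℝ ≤ x * y
*-≥0 {x} {y} 0<x 0≤y = ≮⇒≥ λ xy<0 → ≤⇒≯ 0≤y (begin-strict
  y         ≈⟨ solve 1 (λ y → y := :- :- y) ≈-refl y ⟩
  - - y     <⟨ neg<0 (*-cancel->0 {y = - y} 0<x (begin-strict
    0ℝ         <⟨ neg>0 xy<0 ⟩
    - (x * y)  ≈⟨ solve 2 (λ x y → :- (x :* y) := x :* :- y) ≈-refl x y ⟩
    x * - y    ∎)) ⟩
  0ℝ        ∎)

*-monoˡ-≤ : ∀ {x y z} → 0ℝ < x → y ≤ z → x * y ≤ x * z
*-monoˡ-≤ {x} {y} {z} 0<x y≤z = ≤-by (x * (z - y)) (*-≥0 0<x (diff≥0 y≤z))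
  (solve 3 (λ x y z → x :* y :+ x :* (z :- y) := x :* z) ≈-refl x y z)

*-monoʳ-≤ : ∀ {x y z} → 0ℝ < x → y ≤ z → y * x ≤ z * x
*-monoʳ-≤ {x} {y} {z} 0<x y≤z = begin
  y * x   ≈⟨ *-comm y x ⟩
  x * y   ≤⟨ *-monoˡ-≤ 0<x y≤z ⟩
  x * z   ≈⟨ *-comm x z ⟩
  z * x   ∎

*-monoˡ-< : ∀ {x y z} → 0ℝ < x → y < z → x * y < x * z
*-monoˡ-< {x} {y} {z} 0<x y<z = <-by (x * (z - y)) (*-positive 0<x (<⇒0<- y<z))
  (solve 3 (λ x y z → x :* y :+ x :* (z :- y) := x :* z) ≈-refl x y z)

-- The nonnegative factor need not be bounded away from 0, so it cannot be
-- divided out; y is compared with x y / (1 + x) instead.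
*-cancel-≥0 : ∀ {x y} → 0ℝ ≤ x → 0ℝ < x * y → 0ℝ < y
*-cancel-≥0 {x} {y} 0≤x 0<xy = decide (<-compare 0<η y)
  where
  0<1+x : 0ℝ < 1ℝ + x
  0<1+x = +->0 0<1 0≤x
  η = recip (1ℝ + x) 0<1+x * (x * y)
  0<η : 0ℝ < η
  0<η = *-positive (recip-positive 0<1+x) 0<xy
  decide : 0ℝ < y ⊎ y < η → 0ℝ < y
  decide (inj₁ 0<y) = 0<y
  decide (inj₂ y<η) = contradiction (begin-strict
    x * y                                     ≤⟨ ≤-by ((η - y) * x) (*-≥0 (<⇒0<- y<η) 0≤x)
                                                   (solve 3 (λ x y η → x :* y :+ (η :- y) :* x := x :* η) ≈-refl x y η) ⟩
    x * η                                     <⟨ <-by η 0<η (solve 2 (λ x η → x :* η :+ η := (con 1ℚ :+ x) :* η) ≈-refl x η) ⟩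
    (1ℝ + x) * η                              ≈⟨ solve 3 (λ s r p → s :* (r :* p) := r :* s :* p) ≈-refl (1ℝ + x) (recip (1ℝ + x) 0<1+x) (x * y) ⟩
    recip (1ℝ + x) 0<1+x * (1ℝ + x) * (x * y) ≈⟨ *-congʳ (x * y) (recip-*ˡ (1ℝ + x) 0<1+x) ⟩
    1ℝ * (x * y)                              ≈⟨ *-identityˡ (x * y) ⟩
    x * y                                     ∎) <-irrefl

/-* : ∀ x y → x / y * real y ≈ x
/-* x y = begin-equality
  x * r * real y     ≈⟨ solve 3 (λ x r y → x :* r :* y := x :* (r :* y)) ≈-refl x r (real y) ⟩
  x * (r * real y)   ≈⟨ *-congˡ x (recip-*ˡ (real y) (positive y)) ⟩
  x * 1ℝ             ≈⟨ *-identityʳ x ⟩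
  x                  ∎
  where r = recip (real y) (positive y)

*-cancelʳ-≤ : ∀ {x y z} → 0ℝ < z → x * z ≤ y * z → x ≤ y
*-cancelʳ-≤ {x} {y} {z} 0<z xz≤yz = ≮⇒≥ λ y<x → ≤⇒≯ xz≤yz (begin-strict
  y * z   ≈⟨ *-comm y z ⟩
  z * y   <⟨ *-monoˡ-< 0<z y<x ⟩
  z * x   ≈⟨ *-comm z x ⟩
  x * z   ∎)

*-cancelʳ-≈ : ∀ {x y z} → 0ℝ < z → x * z ≈ y * z → x ≈ y
*-cancelʳ-≈ 0<z p = ≤-antisym (*-cancelʳ-≤ 0<z (≈⇒≤ p)) (*-cancelʳ-≤ 0<z (≈⇒≤ (≈-sym p)))

≤-/ : ∀ {x z} y → x * real y ≤ z → x ≤ z / y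
≤-/ {x} {z} y p = *-cancelʳ-≤ (positive y) (≤-trans p (≈⇒≤ (≈-sym (/-* z y))))

/-≤ : ∀ {x z} y → z ≤ x * real y → z / y ≤ x
/-≤ {x} {z} y p = *-cancelʳ-≤ (positive y) (≤-trans (≈⇒≤ (/-* z y)) p)

x≤x⊔y : ∀ x y → x ≤ x ⊔ y
x≤x⊔y x y = mk≤ λ {ε} 0<ε → 0 , λ n _ → ℚ.≤-trans (ℚ.p≤p⊔q (seq x n) (seq y n)) (Rational.≤-by ε (ℚ.<⇒≤ 0<ε) ≡.refl)

y≤x⊔y : ∀ x y → y ≤ x ⊔ y
y≤x⊔y x y = mk≤ λ {ε} 0<ε → 0 , λ n _ → ℚ.≤-trans (ℚ.p≤q⊔p (seq x n) (seq y n)) (Rational.≤-by ε (ℚ.<⇒≤ 0<ε) ≡.refl)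

⊔-cong : ∀ {x x′ y y′} → x ≈ x′ → y ≈ y′ → x ⊔ y ≈ x′ ⊔ y′
⊔-cong p q = mk≈ (⊔-close (close p) (close q))

-- `Close` compares terms at two independent indices. Equal indices suffice here, since the Cauchy
-- property, used in `≤-antisym`, bridges the rest.
near⇒≈ : ∀ {x y} → (∀ {ε} → 0ℚ ℚ.< ε → ∃ λ N → ∀ n → N ℕ.≤ n → ∣ seq x n ℚ.- seq y n ∣ ℚ.≤ ε) → x ≈ y
near⇒≈ {x} {y} p = ≤-antisym
  (mk≤ λ 0<ε → let P = p 0<ε in proj₁ P , λ n N≤n → Rational.near⇒≤ {seq x n} {seq y n} (proj₂ P n N≤n))
  (mk≤ λ 0<ε → let P = p 0<ε in proj₁ P , λ n N≤n → Rational.near⇒≥ {seq x n} {seq y n} (proj₂ P n N≤n))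

-- The exponential function.

exp-cong : ∀ {x y} → x ≈ y → exp x ≈ exp y
exp-cong p = mk≈ (exp-close (close p))

-- With `u = x / 2ᵏ` and `v = y / 2ᵏ`, the bases `(1 + u) (1 + v)` and `1 + (u + v)` differ by
-- `u v`, of order `4⁻ᵏ`. Raising to the power `2ᵏ` leaves an error of at most `K / 2ᵏ`.
exp-+ : ∀ x y → exp x * exp y ≈ exp (x + y)
exp-+ x y = near⇒≈ λ {ε} 0<ε → let T = ½^-small K 0≤K 0<ε in
  (proj₁ (proj₂ X) ∨ proj₁ (proj₂ Y)) ∨ proj₁ T , λ k N≤k → ℚ.≤-trans
    (approx-+ (proj₁ X) (proj₁ Y) k (proj₂ (proj₂ X) k (∨ˡ (∨ˡ N≤k))) (proj₂ (proj₂ Y) k (∨ʳ (∨ˡ N≤k))))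
    (subst (ℚ._≤ ε) (ℚ.*-assoc (4ℚ ^ proj₁ X ℚ.* 4ℚ ^ proj₁ Y) _ _) (proj₂ T k (∨ʳ N≤k)))
  where
  open Rational hiding (fromℕ)
  X = bounded (cauchy x)
  Y = bounded (cauchy y)
  K : ℚ
  K = 4ℚ ^ proj₁ X ℚ.* 4ℚ ^ proj₁ Y ℚ.* (Rational.fromℕ (proj₁ X) ℚ.* Rational.fromℕ (proj₁ Y))
  0≤K : 0ℚ ℚ.≤ K
  0≤K = Rational.*-≥0 (Rational.*-≥0 (0≤4^ (proj₁ X)) (0≤4^ (proj₁ Y)))
          (Rational.*-≥0 (fromℕ-≥0 (proj₁ X)) (fromℕ-≥0 (proj₁ Y)))

-- Bernoulli's inequality for the approximants, from the index on at which `1 + x / 2ᵏ` is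
-- nonnegative.
1+x≤exp : ∀ x → 1ℝ + x ≤ exp x
1+x≤exp x = mk≤ λ {ε} 0<ε → proj₁ (proj₂ X) ∨ proj₁ B , λ k N≤k → ℚ.≤-trans
    (Rational.approx-≥1+ k {seq x k} (proj₂ B k (∨ʳ N≤k) (proj₂ (proj₂ X) k (∨ˡ N≤k))))
    (Rational.≤-by ε (ℚ.<⇒≤ 0<ε) ≡.refl)
  where
  X = bounded (cauchy x)
  B = Rational.approx-base (proj₁ X)

-- On a bounded interval all late approximants share a positive lower bound, because those of `q`
-- and `- q` have a product near 1.
exp>0 : ∀ x → 0ℝ < exp x
exp>0 x = mk< (proj₁ P , proj₁ (proj₂ P) , proj₁ (proj₂ X) ∨ proj₁ (proj₂ (proj₂ P)) , λ k N≤k →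
    subst (ℚ._≤ approx k (seq x k)) (≡.sym (ℚ.+-identityˡ (proj₁ P)))
      (proj₂ (proj₂ (proj₂ P)) k (∨ʳ N≤k) (proj₂ (proj₂ X) k (∨ˡ N≤k))))
  where
  open Rational using (approx)
  X = bounded (cauchy x)
  P = Rational.approx-positive (proj₁ X)

exp-split : ∀ x y → exp y ≈ exp x * exp (y - x)
exp-split x y = ≈-trans (exp-cong (solve 2 (λ x y → y := x :+ (y :- x)) ≈-refl x y)) (≈-sym (exp-+ x (y - x)))

-- The factor `exp (y - x)` is at least `1 + (y - x)`, so passing from `x` to `y` adds at least
-- `exp x * (y - x)`. The strict version uses the same estimate.
exp-mono-≤ : ∀ {x y} → x ≤ y → exp x ≤ exp y
exp-mono-≤ {x} {y} x≤y = begin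
  exp x                  ≤⟨ ≤-by (exp x * (y - x)) (*-≥0 (exp>0 x) (diff≥0 x≤y))
                              (solve 3 (λ e x y → e :+ e :* (y :- x) := e :* (con 1ℚ :+ (y :- x))) ≈-refl (exp x) x y) ⟩
  exp x * (1ℝ + (y - x)) ≤⟨ *-monoˡ-≤ (exp>0 x) (1+x≤exp (y - x)) ⟩
  exp x * exp (y - x)    ≈⟨ exp-split x y ⟨
  exp y                  ∎

exp-mono-< : ∀ {x y} → x < y → exp x < exp y
exp-mono-< {x} {y} x<y = begin-strict
  exp x                  <⟨ <-by (exp x * (y - x)) (*-positive (exp>0 x) (<⇒0<- x<y))
                              (solve 3 (λ e x y → e :+ e :* (y :- x) := e :* (con 1ℚ :+ (y :- x))) ≈-refl (exp x) x y) ⟩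
  exp x * (1ℝ + (y - x)) ≤⟨ *-monoˡ-≤ (exp>0 x) (1+x≤exp (y - x)) ⟩
  exp x * exp (y - x)    ≈⟨ exp-split x y ⟨
  exp y                  ∎

exp-cancel-≤ : ∀ {x y} → exp x ≤ exp y → x ≤ y
exp-cancel-≤ p = ≮⇒≥ λ y<x → ≤⇒≯ p (exp-mono-< y<x)

exp-injective : ∀ {x y} → exp x ≈ exp y → x ≈ y
exp-injective p = ≤-antisym (exp-cancel-≤ (≈⇒≤ p)) (exp-cancel-≤ (≈⇒≤ (≈-sym p)))

exp-0 : exp 0ℝ ≈ 1ℝ
exp-0 = ≗⇒≈ Rational.approx-0

exp-neg-* : ∀ x → exp (- x) * exp x ≈ 1ℝ
exp-neg-* x = ≈-trans (exp-+ (- x) x) (≈-trans (exp-cong (solve 1 (λ x → :- x :+ x := con 0ℚ) ≈-refl x)) exp-0)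

exp<1⇒<0 : ∀ {x} → exp x < 1ℝ → x < 0ℝ
exp<1⇒<0 {x} p = <-by (1ℝ - (1ℝ + x)) (<⇒0<- (≤-<-trans (1+x≤exp x) p))
  (solve 1 (λ x → x :+ (con 1ℚ :- (con 1ℚ :+ x)) := con 0ℚ) ≈-refl x)

1<exp⇒0< : ∀ {x} → 1ℝ < exp x → 0ℝ < x
1<exp⇒0< {x} p = begin-strict
  0ℝ      <⟨ neg>0 (exp<1⇒<0 { - x} (begin-strict
    exp (- x)           ≈⟨ *-identityʳ (exp (- x)) ⟨
    exp (- x) * 1ℝ      <⟨ *-monoˡ-< (exp>0 (- x)) p ⟩
    exp (- x) * exp x   ≈⟨ exp-neg-* x ⟩
    1ℝ                  ∎)) ⟩
  - - x   ≈⟨ solve 1 (λ x → :- :- x := x) ≈-refl x ⟩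
  x       ∎

fromℚ-positive : ∀ {q} → 0ℚ ℚ.< q → 0ℝ < fromℚ q
fromℚ-positive {q} 0<q = mk< (q , 0<q , 0 , λ _ _ → ℚ.≤-reflexive (ℚ.+-identityˡ q))

-- For u > -2 this is exp u = (exp (u / 2))² ≥ (1 + u / 2)²; for u < -1, 1 + u < 0.
1+u<exp : ∀ u → 0ℝ < u * u → 1ℝ + u < exp u
1+u<exp u 0<u² = decide (<-compare {fromℚ (ℚ.- Rational.2ℚ)} { - 1ℝ} (mk< (1ℚ , Rational.0<1 , 0 , λ _ _ → ℚ.≤-refl)) u)
  where
  v = fromℚ ½ * u
  decide : fromℚ (ℚ.- Rational.2ℚ) < u ⊎ u < - 1ℝ → 1ℝ + u < exp u
  decide (inj₁ -2<u) = begin-strict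
    1ℝ + u                  <⟨ <-by (v * v) (begin-strict
                                 0ℝ                        <⟨ *-positive (fromℚ-positive (ℚ.positive⁻¹ (½ ℚ.* ½))) 0<u² ⟩
                                 fromℚ (½ ℚ.* ½) * (u * u) ≈⟨ solve 1 (λ u → con (½ ℚ.* ½) :* (u :* u) := con ½ :* u :* (con ½ :* u)) ≈-refl u ⟩
                                 v * v                     ∎)
                                 (solve 1 (λ u → con 1ℚ :+ u :+ con ½ :* u :* (con ½ :* u) := (con 1ℚ :+ con ½ :* u) :* (con 1ℚ :+ con ½ :* u)) ≈-refl u) ⟩
    (1ℝ + v) * (1ℝ + v)     ≤⟨ *-monoˡ-≤ 0<1+v (1+x≤exp v) ⟩
    (1ℝ + v) * exp v        ≤⟨ *-monoʳ-≤ (exp>0 v) (1+x≤exp v) ⟩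
    exp v * exp v           ≈⟨ exp-+ v v ⟩
    exp (v + v)             ≈⟨ exp-cong (solve 1 (λ u → con ½ :* u :+ con ½ :* u := u) ≈-refl u) ⟩
    exp u                   ∎
    where
    0<1+v : 0ℝ < 1ℝ + v
    0<1+v = begin-strict
      0ℝ                                       <⟨ *-positive (fromℚ-positive Rational.0<½) (<⇒0<- -2<u) ⟩
      fromℚ ½ * (u - fromℚ (ℚ.- Rational.2ℚ))  ≈⟨ solve 1 (λ u → con ½ :* (u :- con (ℚ.- Rational.2ℚ)) := con 1ℚ :+ con ½ :* u) ≈-refl u ⟩
      1ℝ + v                                   ∎
  decide (inj₂ u<-1) = begin-strict
    1ℝ + u     <⟨ +-monoʳ-< 1ℝ u<-1 ⟩
    1ℝ - 1ℝ    ≈⟨ solve 0 (con 1ℚ :- con 1ℚ := con 0ℚ) ≈-refl ⟩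
    0ℝ         <⟨ exp>0 u ⟩
    exp u      ∎

-- The logarithm as inverse of the exponential.

≤-limit : ∀ {x y} → 0ℝ < x → (∀ {ε} → 0ℚ ℚ.< ε → x * (1ℝ - fromℚ ε) ≤ y) → x ≤ y
≤-limit {x} {y} 0<x p = ≮⇒≥ λ y<x → let
    -- The relative gap `(x - y) / x`. For a rational `h` strictly between 0 and `d`, the number
    -- `x * (1 - h)` exceeds `x * (1 - d)`, which is `y`.
    d = recip x 0<x * (x - y)
    D : 0ℝ < d
    D = *-positive (recip-positive 0<x) (<⇒0<- y<x)
    δ = proj₁ (apart D)
    0<δ = proj₁ (proj₂ (apart D))
    h = ½ ℚ.* δ
    h<d : fromℚ h < d
    h<d = ≤-<-trans (≈⇒≤ (≈-sym (+-identityˡ (fromℚ h)))) (h< D)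
  in ≤⇒≯ (p (Rational.half>0 0<δ)) (begin-strict
    y                                 ≈⟨ solve 2 (λ x y → y := x :- con 1ℚ :* (x :- y)) ≈-refl x y ⟩
    x - 1ℝ * (x - y)                  ≈⟨ +-cong (≈-refl {x}) (-‿cong (*-congʳ (x - y) (recip-*ˡ x 0<x))) ⟨
    x - recip x 0<x * x * (x - y)     ≈⟨ solve 3 (λ r x y → x :- r :* x :* (x :- y) := x :* (con 1ℚ :- r :* (x :- y))) ≈-refl (recip x 0<x) x y ⟩
    x * (1ℝ - d)                      <⟨ *-monoˡ-< 0<x (<-by {1ℝ - d} (d - fromℚ h) (<⇒0<- h<d)
                                           (solve 2 (λ d h → con 1ℚ :- d :+ (d :- h) := con 1ℚ :- h) ≈-refl d (fromℚ h))) ⟩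
    x * (1ℝ - fromℚ h)                ∎)
  where
  h< : ∀ {d} (D : 0ℝ < d) → 0ℝ + fromℚ (½ ℚ.* proj₁ (apart D)) < d
  h< {d} (mk< (δ , 0<δ , N , q)) = mk< (½ ℚ.* δ , Rational.half>0 0<δ , N , λ n N≤n → ℚ.≤-trans
    (ℚ.≤-reflexive (≡.trans (ℚ.+-assoc 0ℚ (½ ℚ.* δ) (½ ℚ.* δ)) (cong (0ℚ ℚ.+_) (Rational.halves δ)))) (q n N≤n))

-- A bracket of width at most `ε` contains `ln y`, and the exponentials of its ends enclose `y`.
-- Hence `exp (ln y)` and `y` each dominate the other up to a factor `1 - ε`, and `≤-limit` removes
-- that factor.
exp-ln : ∀ y → exp (ln y) ≈ real y
exp-ln Y@(y ,⁺ 0<y) = ≤-antisym (≤-limit (exp>0 L) upper-estimate) (≤-limit 0<y lower-estimate)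
  where
  open Brackets 0<y
  open Bracket
  L = ln Y
  lo≤L : ∀ k → fromℚ (lo (brackets k)) ≤ L
  lo≤L k = mk≤ λ {ε} 0<ε → k , λ n k≤n → ℚ.≤-trans (los (ℕ.≤⇒≤′ k≤n)) (Rational.≤-by ε (ℚ.<⇒≤ 0<ε) ≡.refl)
  L≤hi : ∀ k → L ≤ fromℚ (hi (brackets k))
  L≤hi k = mk≤ λ {ε} 0<ε → k , λ n k≤n → ℚ.≤-trans (ℚ.<⇒≤ (lo<hi (brackets n)))
    (ℚ.≤-trans (his (ℕ.≤⇒≤′ k≤n)) (Rational.≤-by ε (ℚ.<⇒≤ 0<ε) ≡.refl))
  fromℚ-mono : ∀ {p q} → p ℚ.≤ q → fromℚ p ≤ fromℚ q
  fromℚ-mono p≤q = mk≤ λ {ε} 0<ε → 0 , λ _ _ → ℚ.≤-trans p≤q (Rational.≤-by ε (ℚ.<⇒≤ 0<ε) ≡.refl)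
  -- A step down from `b` to `a` multiplies the exponential by `exp (a - b)`, which is at least
  -- `1 + (a - b)` and so at least `1 - w`.
  exp-estimate : ∀ {z a b} w → 0ℝ < z → z ≤ exp b → b - a ≤ w → z * (1ℝ - w) ≤ exp a
  exp-estimate {z} {a} {b} w 0<z z≤expb b-a≤w = begin
    z * (1ℝ - w)          ≤⟨ *-monoˡ-≤ 0<z (≤-by {1ℝ - w} (w - (b - a)) (diff≥0 b-a≤w)
                               (solve 3 (λ a b w → con 1ℚ :- w :+ (w :- (b :- a)) := con 1ℚ :+ (a :- b)) ≈-refl a b w)) ⟩
    z * (1ℝ + (a - b))    ≤⟨ *-monoˡ-≤ 0<z (1+x≤exp (a - b)) ⟩
    z * exp (a - b)       ≤⟨ *-monoʳ-≤ (exp>0 (a - b)) z≤expb ⟩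
    exp b * exp (a - b)   ≈⟨ exp-split b a ⟨
    exp a                 ∎
  module _ {ε} (0<ε : 0ℚ ℚ.< ε) where
    k = proj₁ (widths-small 0<ε)
    b = brackets k
    l = fromℚ (lo b)
    h = fromℚ (hi b)
    h-l≤ε : h - l ≤ fromℚ ε
    h-l≤ε = ≤-trans (≈⇒≤ (≗⇒≈ λ _ → ≡.refl)) (fromℚ-mono (proj₂ (widths-small 0<ε) k ℕ.≤-refl))
    upper-estimate : exp L * (1ℝ - fromℚ ε) ≤ y
    upper-estimate = ≤-trans
      (exp-estimate {exp L} {l} {L} (fromℚ ε) (exp>0 L) ≤-refl (≤-trans (+-mono-≤ (L≤hi k) (≤-refl { - l})) h-l≤ε))
      (<⇒≤ (lower b))
    lower-estimate : y * (1ℝ - fromℚ ε) ≤ exp L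
    lower-estimate = exp-estimate {y} {L} {h} (fromℚ ε) 0<y (<⇒≤ (upper b))
      (≤-trans (+-mono-≤ (≤-refl {h}) (≤-by { - L} (L - l) (diff≥0 (lo≤L k))
        (solve 2 (λ l L → :- L :+ (L :- l) := :- l) ≈-refl l L))) h-l≤ε)

-- Finite sums and maxima.

open SemiringSum (CommutativeRing.semiring ℝ-commutativeRing)
  using (∑-distrib-+; ∑-comm; *-distribˡ-sum; *-distribʳ-sum) renaming (sum-cong-≋ to ∑-cong)

∑-mono-≤ : ∀ {n} {f g : Vector ℝ n} → (∀ i → f i ≤ g i) → ∑ f ≤ ∑ g
∑-mono-≤ {zero}  p = ≤-refl
∑-mono-≤ {suc n} p = +-mono-≤ (p zero) (∑-mono-≤ λ i → p (suc i))

∑-const : ∀ n c → ∑ {n} (λ _ → c) ≈ fromℕ n * c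
∑-const zero    c = ≈-sym (zeroˡ c)
∑-const (suc n) c = begin-equality
  c + ∑ {n} (λ _ → c)    ≈⟨ +-cong (≈-refl {c}) (∑-const n c) ⟩
  c + fromℕ n * c        ≈⟨ solve 2 (λ n c → c :+ n :* c := (con 1ℚ :+ n) :* c) ≈-refl (fromℕ n) c ⟩
  (1ℝ + fromℕ n) * c     ≈⟨ *-congʳ c (≗⇒≈ {1ℝ + fromℕ n} {fromℕ (suc n)} λ _ → ≡.refl) ⟩
  fromℕ (suc n) * c      ∎

∑-≥0 : ∀ {n} {f : Vector ℝ n} → (∀ i → 0ℝ ≤ f i) → 0ℝ ≤ ∑ f
∑-≥0 {zero}  p = ≤-refl
∑-≥0 {suc n} p = +-≥0 (p zero) (∑-≥0 λ i → p (suc i))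

term≤∑ : ∀ {n} {f : Vector ℝ n} → (∀ i → 0ℝ ≤ f i) → ∀ i → f i ≤ ∑ f
term≤∑ {f = f} p zero    = ≤-by (∑ λ i → f (suc i)) (∑-≥0 λ i → p (suc i)) ≈-refl
term≤∑ {f = f} p (suc i) = ≤-trans (term≤∑ (λ i → p (suc i)) i)
  (≤-by (f zero) (p zero) (solve 2 (λ x y → y :+ x := x :+ y) ≈-refl (f zero) (∑ λ i → f (suc i))))

-- The sign of a term cannot be tested, but the first term can be located between 0 and the total:
-- either it is positive, or it is below the total and the remaining sum is positive.
∑>0⇒∃>0 : ∀ {n} (f : Vector ℝ n) → 0ℝ < ∑ f → ∃ λ i → 0ℝ < f i
∑>0⇒∃>0 {zero}  f 0<∑ = contradiction 0<∑ <-irrefl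
∑>0⇒∃>0 {suc n} f 0<∑ = decide (<-compare 0<∑ (f zero))
  where
  rest = ∑ λ i → f (suc i)
  decide : 0ℝ < f zero ⊎ f zero < f zero + rest → ∃ λ i → 0ℝ < f i
  decide (inj₁ 0<f₀) = zero , 0<f₀
  decide (inj₂ f₀<∑) = let
      found = ∑>0⇒∃>0 (λ i → f (suc i)) (<-≤-trans (<⇒0<- f₀<∑)
        (≈⇒≤ (solve 2 (λ x y → x :+ y :- x := y) ≈-refl (f zero) rest)))
    in suc (proj₁ found) , proj₂ found

term≤maximum : ∀ {n} .{{_ : ℕ.NonZero n}} (f : Vector ℝ n) i → f i ≤ maximum f
term≤maximum {1}           f zero    = ≤-refl
term≤maximum {suc (suc n)} f zero    = x≤x⊔y (f zero) (maximum λ i → f (suc i))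
term≤maximum {suc (suc n)} f (suc i) = ≤-trans (term≤maximum (λ i → f (suc i)) i) (y≤x⊔y (f zero) (maximum λ i → f (suc i)))

maximum-cong : ∀ {n} .{{_ : ℕ.NonZero n}} {f g : Vector ℝ n} → (∀ i → f i ≈ g i) → maximum f ≈ maximum g
maximum-cong {1}           p = p zero
maximum-cong {suc (suc n)} p = ⊔-cong (p zero) (maximum-cong λ i → p (suc i))

-- With two or more terms the threshold may exceed 1, since besides z i the sum
-- contains another term, which is at least δ.
threshold : ∀ {n} (c e : Vector ℝ n) → (∀ i → c i < 1ℝ) → ∑ c ≤ 1ℝ →
  ∃ λ C → ∑ c < C × (∀ z → (∀ i → exp (e i) ≤ z i) → ∑ z < C → ∀ i → z i < 1ℝ)
threshold {0} c e c<1 ∑c≤1 = 1ℝ , 0<1 , λ _ _ _ ()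
-- A single term leaves no slack above 1; here the strict bound comes from `c<1` instead of the sum.
threshold {1} c e c<1 ∑c≤1 = 1ℝ , ≤-<-trans (≈⇒≤ (+-identityʳ (c zero))) (c<1 zero) ,
  λ { z _ ∑z<1 zero → ≤-<-trans (≈⇒≤ (≈-sym (+-identityʳ (z zero)))) ∑z<1 }
threshold {suc (suc n)} c e c<1 ∑c≤1 = 1ℝ + δ , ≤-<-trans ∑c≤1 (<-by δ (exp>0 t) ≈-refl) , below-1
  where
  -- The minimum of the `e i`, which makes `δ` a lower bound for every `z i`.
  t = - maximum (λ i → - e i)
  δ = exp t
  t≤e : ∀ i → t ≤ e i
  t≤e i = ≤-by { t} (e i + maximum (λ i → - e i))
    (≤-trans (diff≥0 (term≤maximum (λ i → - e i) i))
      (≈⇒≤ (solve 2 (λ m e → m :- (:- e) := e :+ m) ≈-refl (maximum (λ i → - e i)) (e i))))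
    (solve 2 (λ m e → :- m :+ (e :+ m) := e) ≈-refl (maximum (λ i → - e i)) (e i))
  below-1 : ∀ z → (∀ i → exp (e i) ≤ z i) → ∑ z < 1ℝ + δ → ∀ i → z i < 1ℝ
  below-1 z e≤z ∑z<C i = begin-strict
    z i              ≈⟨ solve 2 (λ z d → z := z :+ d :- d) ≈-refl (z i) δ ⟩
    z i + δ - δ      ≤⟨ +-mono-≤ (z+δ≤∑ i) (≤-refl { - δ}) ⟩
    ∑ z - δ          ≈⟨ solve 2 (λ z d → z :- d := :- d :+ z) ≈-refl (∑ z) δ ⟩
    - δ + ∑ z        <⟨ +-monoʳ-< (- δ) ∑z<C ⟩
    - δ + (1ℝ + δ)   ≈⟨ solve 1 (λ d → :- d :+ (con 1ℚ :+ d) := con 1ℚ) ≈-refl δ ⟩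
    1ℝ               ∎
    where
    δ≤z : ∀ i → δ ≤ z i
    δ≤z i = ≤-trans (exp-mono-≤ (t≤e i)) (e≤z i)
    0≤z : ∀ i → 0ℝ ≤ z i
    0≤z i = ≤-trans (<⇒≤ (exp>0 t)) (δ≤z i)
    rest = ∑ λ i → z (suc i)
    z+δ≤∑ : ∀ i → z i + δ ≤ ∑ z
    z+δ≤∑ zero    = +-mono-≤ (≤-refl {z zero}) (≤-trans (δ≤z (suc zero)) (term≤∑ (λ i → 0≤z (suc i)) zero))
    z+δ≤∑ (suc i) = ≤-trans (+-mono-≤ (term≤∑ (λ i → 0≤z (suc i)) i) (δ≤z zero))
      (≈⇒≤ (solve 2 (λ r z → r :+ z := z :+ r) ≈-refl rest (z zero)))

-- Averaging over a finite probability space.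

module _ {ℓ} (𝒮 : FiniteProbabilitySpace ℓ) where
  open FiniteProbabilitySpace 𝒮 using (size; outcome; weight; weight≥0; weight-sum)

  -- This one form serves for `c - f`, for scaling by a constant, and for likelihood ratios, which
  -- are affine in the observed bit.
  𝔼-affine : ∀ f a b → 𝔼 𝒮 (λ s → f s * a + b) ≈ 𝔼 𝒮 f * a + b
  𝔼-affine f a b = begin-equality
    𝔼 𝒮 (λ s → f s * a + b)
      ≈⟨ ∑-cong (λ k → solve 4 (λ w f a b → w :* (f :* a :+ b) := w :* f :* a :+ w :* b) ≈-refl (weight (outcome k)) (f (outcome k)) a b) ⟩
    ∑ (λ k → wf k * a + w k * b)
      ≈⟨ ∑-distrib-+ (λ k → wf k * a) (λ k → w k * b) ⟩
    ∑ (λ k → wf k * a) + ∑ (λ k → w k * b)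
      ≈⟨ +-cong (*-distribʳ-sum a wf) (*-distribʳ-sum b w) ⟨
    𝔼 𝒮 f * a + ∑ w * b
      ≈⟨ +-cong (≈-refl {𝔼 𝒮 f * a}) (≈-trans (*-congʳ b weight-sum) (*-identityˡ b)) ⟩
    𝔼 𝒮 f * a + b ∎
    where
    w wf : Fin size → ℝ
    w k = weight (outcome k)
    wf k = w k * f (outcome k)

  𝔼-∑ : ∀ {n} (f : Fin n → Ω 𝒮 → ℝ) → 𝔼 𝒮 (λ s → ∑ (λ i → f i s)) ≈ ∑ (λ i → 𝔼 𝒮 (f i))
  𝔼-∑ f = ≈-trans (∑-cong (λ k → *-distribˡ-sum (weight (outcome k)) (λ i → f i (outcome k))))
    (∑-comm (λ k i → weight (outcome k) * f i (outcome k)))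

  -- The mean of `c - f` is positive, so some weighted term is. Its weight is only known to be
  -- nonnegative, which is why `*-cancel-≥0` is needed.
  below-average : ∀ f {c} → 𝔼 𝒮 f < c → ∃ λ s → f s < c
  below-average f {c} 𝔼f<c = outcome k , <-by {f (outcome k)} (f (outcome k) * - 1ℝ + c) (*-cancel-≥0 (weight≥0 (outcome k)) 0<wd)
      (solve 2 (λ f c → f :+ (f :* (:- con 1ℚ) :+ c) := c) ≈-refl (f (outcome k)) c)
    where
    0<𝔼 : 0ℝ < 𝔼 𝒮 (λ s → f s * - 1ℝ + c)
    0<𝔼 = begin-strict
      0ℝ                            <⟨ <⇒0<- 𝔼f<c ⟩
      c - 𝔼 𝒮 f                     ≈⟨ solve 2 (λ e c → c :- e := e :* (:- con 1ℚ) :+ c) ≈-refl (𝔼 𝒮 f) c ⟩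
      𝔼 𝒮 f * - 1ℝ + c              ≈⟨ 𝔼-affine f (- 1ℝ) c ⟨
      𝔼 𝒮 (λ s → f s * - 1ℝ + c)    ∎
    found = ∑>0⇒∃>0 (λ k → weight (outcome k) * (f (outcome k) * - 1ℝ + c)) 0<𝔼
    k = proj₁ found
    0<wd = proj₂ found

  -- Method of conditional expectations: the sample is drawn one point at a time.
  sample : ∀ {n} (g : Fin n → Ω 𝒮 → ℝ) → (∀ i → 𝔼 𝒮 (λ s → exp (g i s)) ≤ 1ℝ) →
    ∀ m (x : Vector ℝ n) {C} → ∑ (λ i → exp (x i)) < C →
    Σ (Vector (Ω 𝒮) m) λ S → ∑ (λ i → exp (x i + ∑ (λ k → g i (S k)))) < C
  sample g 𝔼g≤1 zero    x ∑<C = [] , ≤-<-trans (≈⇒≤ (∑-cong λ i → exp-cong (+-identityʳ (x i)))) ∑<C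
  sample g 𝔼g≤1 (suc m) x {C} ∑<C = s ∷ S , (begin-strict
    ∑ (λ i → exp (x i + (g i s + ∑ (λ k → g i (S k)))))
      ≈⟨ ∑-cong (λ i → exp-cong (solve 3 (λ x y z → x :+ (y :+ z) := x :+ y :+ z) ≈-refl (x i) (g i s) (∑ (λ k → g i (S k))))) ⟩
    ∑ (λ i → exp (x i + g i s + ∑ (λ k → g i (S k))))
      <⟨ proj₂ later ⟩
    C ∎)
    where
    -- A new point multiplies the i-th summand by `exp (g i s)`, whose mean is at most 1, so the sum
    -- does not grow on average.
    𝔼<C : 𝔼 𝒮 (λ s → ∑ (λ i → exp (x i + g i s))) < C
    𝔼<C = begin-strict
      𝔼 𝒮 (λ s → ∑ (λ i → exp (x i + g i s)))   ≈⟨ 𝔼-∑ (λ i s → exp (x i + g i s)) ⟩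
      ∑ (λ i → 𝔼 𝒮 (λ s → exp (x i + g i s)))   ≤⟨ ∑-mono-≤ (λ i → begin
        𝔼 𝒮 (λ s → exp (x i + g i s))              ≈⟨ ∑-cong (λ k → *-congˡ (weight (outcome k)) (≈-trans (≈-sym (exp-+ (x i) (g i (outcome k))))
                                                        (solve 2 (λ a b → a :* b := b :* a :+ con 0ℚ) ≈-refl (exp (x i)) (exp (g i (outcome k)))))) ⟩
        𝔼 𝒮 (λ s → exp (g i s) * exp (x i) + 0ℝ)   ≈⟨ 𝔼-affine (λ s → exp (g i s)) (exp (x i)) 0ℝ ⟩
        𝔼 𝒮 (λ s → exp (g i s)) * exp (x i) + 0ℝ   ≈⟨ +-identityʳ (𝔼 𝒮 (λ s → exp (g i s)) * exp (x i)) ⟩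
        𝔼 𝒮 (λ s → exp (g i s)) * exp (x i)        ≤⟨ *-monoʳ-≤ (exp>0 (x i)) (𝔼g≤1 i) ⟩
        1ℝ * exp (x i)                             ≈⟨ *-identityˡ (exp (x i)) ⟩
        exp (x i)                                  ∎) ⟩
      ∑ (λ i → exp (x i))                       <⟨ ∑<C ⟩
      C                                         ∎
    first = below-average (λ s → ∑ (λ i → exp (x i + g i s))) 𝔼<C
    s = proj₁ first
    later = sample g 𝔼g≤1 m (λ i → x i + g i s) (proj₂ first)
    S = proj₁ later

-- Likelihood ratios and relative entropy.

*-exp-neg : ∀ x y {z} → x * exp y ≈ z → z * exp (- y) ≈ x
*-exp-neg x y {z} xeʸ≈z = begin-equality
  z * exp (- y)             ≈⟨ *-congʳ (exp (- y)) xeʸ≈z ⟨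
  x * exp y * exp (- y)     ≈⟨ solve 3 (λ x e f → x :* e :* f := x :* (f :* e)) ≈-refl x (exp y) (exp (- y)) ⟩
  x * (exp (- y) * exp y)   ≈⟨ *-congˡ x (exp-neg-* y) ⟩
  x * 1ℝ                    ≈⟨ *-identityʳ x ⟩
  x                         ∎

-- Clearing the denominator keeps reciprocals out of the later computations with likelihood ratios.
*-exp-ln-/ : ∀ x y → real y * exp (ln (x /⁺ y)) ≈ real x
*-exp-ln-/ x y = begin-equality
  real y * exp (ln (x /⁺ y))   ≈⟨ *-congˡ (real y) (exp-ln (x /⁺ y)) ⟩
  real y * (real x / y)        ≈⟨ *-comm (real y) (real x / y) ⟩
  real x / y * real y          ≈⟨ /-* (real x) y ⟩
  real x                       ∎

ln-/-<0 : ∀ {x y} → real x < real y → ln (x /⁺ y) < 0ℝ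
ln-/-<0 {x} {y} x<y = exp<1⇒<0 (<-by (1ℝ - e) (*-cancel->0 (positive y) (begin-strict
  0ℝ                    <⟨ <⇒0<- x<y ⟩
  real y - real x       ≈⟨ +-cong (≈-refl {real y}) (-‿cong (*-exp-ln-/ x y)) ⟨
  real y - real y * e   ≈⟨ solve 2 (λ y e → y :- y :* e := y :* (con 1ℚ :- e)) ≈-refl (real y) e ⟩
  real y * (1ℝ - e)     ∎))
  (solve 1 (λ e → e :+ (con 1ℚ :- e) := con 1ℚ) ≈-refl e))
  where e = exp (ln (x /⁺ y))

ln-/->0 : ∀ {x y} → real y < real x → 0ℝ < ln (x /⁺ y)
ln-/->0 {x} {y} y<x = 1<exp⇒0< (<-by (e - 1ℝ) (*-cancel->0 (positive y) (begin-strict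
  0ℝ                    <⟨ <⇒0<- y<x ⟩
  real x - real y       ≈⟨ +-cong (*-exp-ln-/ x y) (≈-refl { - real y}) ⟨
  real y * e - real y   ≈⟨ solve 2 (λ y e → y :* e :- y := y :* (e :- con 1ℚ)) ≈-refl (real y) e ⟩
  real y * (e - 1ℝ)     ∎))
  (solve 1 (λ e → con 1ℚ :+ (e :- con 1ℚ) := e) ≈-refl e))
  where e = exp (ln (x /⁺ y))

1-anti-< : ∀ {x y} → x < y → 1ℝ - y < 1ℝ - x
1-anti-< {x} {y} x<y = <-by {1ℝ - y} (y - x) (<⇒0<- x<y)
  (solve 2 (λ x y → con 1ℚ :- y :+ (y :- x) := con 1ℚ :- x) ≈-refl x y)

square>0 : ∀ {x} → x < 0ℝ ⊎ 0ℝ < x → 0ℝ < x * x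
square>0 {x} (inj₁ x<0) = <-≤-trans (*-positive (neg>0 x<0) (neg>0 x<0))
  (≈⇒≤ (solve 1 (λ x → (:- x) :* (:- x) := x :* x) ≈-refl x))
square>0 {x} (inj₂ 0<x) = *-positive 0<x 0<x

-- exp (score b) is the likelihood ratio of the outcome b under the parameters
-- lam and p.
module LikelihoodRatio (lam p : 𝕀) where
  l π A B a : ℝ
  l = value lam
  π = value p
  A = ln (value⁺ lam /⁺ value⁺ p)
  B = ln (1-value⁺ lam /⁺ 1-value⁺ p)
  a = A - B

  score : Fin 2 → ℝ
  score b = bit b * a + B

  π*expA : π * exp A ≈ l
  π*expA = *-exp-ln-/ (value⁺ lam) (value⁺ p)

  [1-π]*expB : (1ℝ - π) * exp B ≈ 1ℝ - l
  [1-π]*expB = *-exp-ln-/ (1-value⁺ lam) (1-value⁺ p)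

  lower-A : l < π → A < 0ℝ
  lower-A = ln-/-<0 {value⁺ lam} {value⁺ p}

  lower-B : l < π → 0ℝ < B
  lower-B l<π = ln-/->0 {1-value⁺ lam} {1-value⁺ p} (1-anti-< l<π)

  upper-A : π < l → 0ℝ < A
  upper-A = ln-/->0 {value⁺ lam} {value⁺ p}

  upper-B : π < l → B < 0ℝ
  upper-B π<l = ln-/-<0 {1-value⁺ lam} {1-value⁺ p} (1-anti-< π<l)

  lower-A<B : l < π → A < B
  lower-A<B l<π = <-trans (lower-A l<π) (lower-B l<π)

  upper-B<A : π < l → B < A
  upper-B<A π<l = <-trans (upper-B π<l) (upper-A π<l)

  score-0 : score zero ≈ B
  score-0 = solve 2 (λ a b → con 0ℚ :* a :+ b := b) ≈-refl a B

  score-1 : score (suc zero) ≈ A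
  score-1 = solve 2 (λ a b → con 1ℚ :* (a :- b) :+ b := a) ≈-refl A B

  -- Every function of a bit is affine, so the mean of the likelihood ratio depends only on the mean
  -- of the bit.
  exp-score : ∀ b → exp (score b) ≈ bit b * (exp A - exp B) + exp B
  exp-score zero       = ≈-trans (exp-cong score-0) (solve 2 (λ a b → b := con 0ℚ :* (a :- b) :+ b) ≈-refl (exp A) (exp B))
  exp-score (suc zero) = ≈-trans (exp-cong score-1) (solve 2 (λ a b → a := con 1ℚ :* (a :- b) :+ b) ≈-refl (exp A) (exp B))

  -- A lower bound for all scores that is known before any point is drawn, as `threshold` requires.
  minScore : ℝ
  minScore = - (- A ⊔ - B)

  minScore≤ : ∀ b → minScore ≤ score b
  minScore≤ zero = ≤-trans (≤-by {minScore} ((- A ⊔ - B) - (- B)) (diff≥0 (y≤x⊔y (- A) (- B)))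
    (solve 2 (λ m b → :- m :+ (m :- (:- b)) := b) ≈-refl (- A ⊔ - B) B)) (≈⇒≤ (≈-sym score-0))
  minScore≤ (suc zero) = ≤-trans (≤-by {minScore} ((- A ⊔ - B) - (- A)) (diff≥0 (x≤x⊔y (- A) (- B)))
    (solve 2 (λ m a → :- m :+ (m :- (:- a)) := a) ≈-refl (- A ⊔ - B) A)) (≈⇒≤ (≈-sym score-1))

  -- At `μ = π` the left side is `l + (1 - l)`. Its slope in `μ` is `exp A - exp B`, and in both
  -- cases `μ` lies on the side of `π` where the value does not increase.
  expected-ratio≤1 : ∀ μ → (exp A < exp B × π ≤ μ) ⊎ (exp B < exp A × μ ≤ π) → μ * (exp A - exp B) + exp B ≤ 1ℝ
  expected-ratio≤1 μ side = ≤-by ((π - μ) * (exp A - exp B)) (gap side) (begin-equality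
    μ * (exp A - exp B) + exp B + (π - μ) * (exp A - exp B)
      ≈⟨ solve 4 (λ μ π a b → μ :* (a :- b) :+ b :+ (π :- μ) :* (a :- b) := π :* a :+ (con 1ℚ :- π) :* b) ≈-refl μ π (exp A) (exp B) ⟩
    π * exp A + (1ℝ - π) * exp B
      ≈⟨ +-cong π*expA [1-π]*expB ⟩
    l + (1ℝ - l)
      ≈⟨ solve 1 (λ l → l :+ (con 1ℚ :- l) := con 1ℚ) ≈-refl l ⟩
    1ℝ ∎)
    where
    gap : (exp A < exp B × π ≤ μ) ⊎ (exp B < exp A × μ ≤ π) → 0ℝ ≤ (π - μ) * (exp A - exp B)
    gap (inj₁ (A<B , π≤μ)) = ≤-trans (*-≥0 (<⇒0<- A<B) (diff≥0 π≤μ))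
      (≈⇒≤ (solve 4 (λ μ π a b → (b :- a) :* (μ :- π) := (π :- μ) :* (a :- b)) ≈-refl μ π (exp A) (exp B)))
    gap (inj₂ (B<A , μ≤π)) = ≤-trans (*-≥0 (<⇒0<- B<A) (diff≥0 μ≤π)) (≈⇒≤ (*-comm (exp A - exp B) (π - μ)))

  -- Gibbs' inequality: bounding `1 - A` and `1 - B` by `exp (- A)` and `exp (- B)` bounds `1 - KL`
  -- by `π + (1 - π)`. The bound on `1 - A` is strict because `A` is apart from 0.
  KL-positive : l < π ⊎ π < l → 0ℝ < KL lam p
  KL-positive l≢π = begin-strict
    0ℝ
      <⟨ <⇒0<- 1-KL<1 ⟩
    1ℝ - (l * (1ℝ - A) + (1ℝ - l) * (1ℝ - B))
      ≈⟨ solve 3 (λ l a b → con 1ℚ :- (l :* (con 1ℚ :- a) :+ (con 1ℚ :- l) :* (con 1ℚ :- b)) := l :* a :+ (con 1ℚ :- l) :* b) ≈-refl l A B ⟩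
    KL lam p ∎
    where
    A≢0 : A < 0ℝ ⊎ 0ℝ < A
    A≢0 = [ (λ l<π → inj₁ (lower-A l<π)) , (λ π<l → inj₂ (upper-A π<l)) ]′ l≢π
    0<A² : 0ℝ < - A * - A
    0<A² = <-≤-trans (square>0 A≢0) (≈⇒≤ (solve 1 (λ a → a :* a := (:- a) :* (:- a)) ≈-refl A))
    1-KL<1 : l * (1ℝ - A) + (1ℝ - l) * (1ℝ - B) < 1ℝ
    1-KL<1 = begin-strict
      l * (1ℝ - A) + (1ℝ - l) * (1ℝ - B)        ≤⟨ +-mono-≤ (≤-refl {l * (1ℝ - A)}) (*-monoˡ-≤ (positive (1-value⁺ lam)) (1+x≤exp (- B))) ⟩
      l * (1ℝ - A) + (1ℝ - l) * exp (- B)       ≈⟨ solve 2 (λ x y → x :+ y := y :+ x) ≈-refl (l * (1ℝ - A)) ((1ℝ - l) * exp (- B)) ⟩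
      (1ℝ - l) * exp (- B) + l * (1ℝ - A)       <⟨ +-monoʳ-< ((1ℝ - l) * exp (- B)) (*-monoˡ-< (0< lam) (1+u<exp (- A) 0<A²)) ⟩
      (1ℝ - l) * exp (- B) + l * exp (- A)      ≈⟨ +-cong (*-exp-neg (1ℝ - π) B [1-π]*expB) (*-exp-neg π A π*expA) ⟩
      (1ℝ - π) + π                              ≈⟨ solve 1 (λ π → con 1ℚ :- π :+ π := con 1ℚ) ≈-refl π ⟩
      1ℝ                                        ∎

  ∑score : ∀ m (b : Vector (Fin 2) m) → ∑ (λ k → score (b k)) ≈ ∑ (λ k → bit (b k)) * a + fromℕ m * B
  ∑score m b = ≈-trans (∑-distrib-+ (λ k → bit (b k) * a) (λ _ → B))
    (+-cong (≈-sym (*-distribʳ-sum a (λ k → bit (b k)))) (∑-const m B))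

  -- Since `KL lam p` equals `l * a + B`, the `m` copies of `B` cancel.
  exponent : ∀ m (b : Vector (Fin 2) m) →
    - (KL lam p * fromℕ m) + ∑ (λ k → score (b k)) ≈ a * (∑ (λ k → bit (b k)) - l * fromℕ m)
  exponent m b = ≈-trans (+-cong (≈-refl { - (KL lam p * fromℕ m)}) (∑score m b))
    (solve 5 (λ l A B t m → :- ((l :* A :+ (con 1ℚ :- l) :* B) :* m) :+ (t :* (A :- B) :+ m :* B) := (A :- B) :* (t :- l :* m))
      ≈-refl l A B (∑ λ k → bit (b k)) (fromℕ m))

  m*minScore≤ : ∀ m (b : Vector (Fin 2) m) → fromℕ m * minScore ≤ ∑ (λ k → score (b k))
  m*minScore≤ m b = ≤-trans (≈⇒≤ (≈-sym (∑-const m minScore))) (∑-mono-≤ λ k → minScore≤ (b k))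

  module _ m (b : Vector (Fin 2) m) (<1 : exp (- (KL lam p * fromℕ m) + ∑ (λ k → score (b k))) < 1ℝ) where
    t = ∑ λ k → bit (b k)
    a*<0 : a * (t - l * fromℕ m) < 0ℝ
    a*<0 = ≤-<-trans (≈⇒≤ (≈-sym (exponent m b))) (exp<1⇒<0 <1)

    lower-tail : l < π → l * fromℕ m ≤ t
    lower-tail l<π = ≤-by (t - l * fromℕ m) (<⇒≤ (*-cancel->0 (<⇒0<- (lower-A<B l<π)) (begin-strict
      0ℝ                              <⟨ neg>0 a*<0 ⟩
      - (a * (t - l * fromℕ m))       ≈⟨ solve 3 (λ A B d → :- ((A :- B) :* d) := (B :- A) :* d) ≈-refl A B (t - l * fromℕ m) ⟩
      (B - A) * (t - l * fromℕ m)     ∎)))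
      (solve 2 (λ x y → x :+ (y :- x) := y) ≈-refl (l * fromℕ m) t)

    upper-tail : π < l → t ≤ l * fromℕ m
    upper-tail π<l = ≤-by (l * fromℕ m - t) (<⇒≤ (*-cancel->0 (<⇒0<- (upper-B<A π<l)) (begin-strict
      0ℝ                              <⟨ neg>0 a*<0 ⟩
      - (a * (t - l * fromℕ m))       ≈⟨ solve 3 (λ a t s → :- (a :* (t :- s)) := a :* (s :- t)) ≈-refl a t (l * fromℕ m) ⟩
      a * (l * fromℕ m - t)           ∎)))
      (solve 2 (λ x y → x :+ (y :- x) := y) ≈-refl t (l * fromℕ m))

  -- The entropy to base `q = 1 / (1 - π)` and its relation to relative entropy.

  Q : ℝ
  Q = ln (base⁺ 1/[1- p ])

  Q⁺ : ℝ⁺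
  Q⁺ = Q ,⁺ ln-positive (base⁺ 1/[1- p ]) (>1 1/[1- p ])

  q = base 1/[1- p ]

  q*[1-π] : q * (1ℝ - π) ≈ 1ℝ
  q*[1-π] = recip-*ˡ (1ℝ - π) (positive (1-value⁺ p))

  exp-Q- : ∀ x → exp (Q - x) ≈ q * exp (- x)
  exp-Q- x = ≈-trans (≈-sym (exp-+ Q (- x))) (*-congʳ (exp (- x)) (exp-ln (base⁺ 1/[1- p ])))

  -- From `q (1 - π) = 1` follows `q - 1 = q π`, and `π / l` is `exp (- A)`.
  ln[q-1]/l : ln (base-1⁺ 1/[1- p ] /⁺ value⁺ lam) ≈ Q - A
  ln[q-1]/l = exp-injective (*-cancelʳ-≈ (0< lam) (begin-equality
    exp u * l                  ≈⟨ *-comm (exp u) l ⟩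
    l * exp u                  ≈⟨ *-exp-ln-/ (base-1⁺ 1/[1- p ]) (value⁺ lam) ⟩
    q - 1ℝ                     ≈⟨ +-cong (≈-refl {q}) (-‿cong q*[1-π]) ⟨
    q - q * (1ℝ - π)           ≈⟨ solve 2 (λ q π → q :- q :* (con 1ℚ :- π) := q :* π) ≈-refl q π ⟩
    q * π                      ≈⟨ *-congˡ q (*-exp-neg π A π*expA) ⟨
    q * (l * exp (- A))        ≈⟨ solve 3 (λ q l e → q :* (l :* e) := q :* e :* l) ≈-refl q l (exp (- A)) ⟩
    q * exp (- A) * l          ≈⟨ *-congʳ l (exp-Q- A) ⟨
    exp (Q - A) * l            ∎))
    where u = ln (base-1⁺ 1/[1- p ] /⁺ value⁺ lam)

  -- Here 1 is rewritten as `q (1 - π)`, and `(1 - π) / (1 - l)` is `exp (- B)`.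
  ln1/[1-l] : ln (1⁺ /⁺ 1-value⁺ lam) ≈ Q - B
  ln1/[1-l] = exp-injective (*-cancelʳ-≈ (positive (1-value⁺ lam)) (begin-equality
    exp u * (1ℝ - l)           ≈⟨ *-comm (exp u) (1ℝ - l) ⟩
    (1ℝ - l) * exp u           ≈⟨ *-exp-ln-/ 1⁺ (1-value⁺ lam) ⟩
    1ℝ                         ≈⟨ q*[1-π] ⟨
    q * (1ℝ - π)               ≈⟨ *-congˡ q (*-exp-neg (1ℝ - π) B [1-π]*expB) ⟨
    q * ((1ℝ - l) * exp (- B)) ≈⟨ solve 3 (λ q l e → q :* (l :* e) := q :* e :* l) ≈-refl q (1ℝ - l) (exp (- B)) ⟩
    q * exp (- B) * (1ℝ - l)   ≈⟨ *-congʳ (1ℝ - l) (exp-Q- B) ⟨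
    exp (Q - B) * (1ℝ - l)     ∎))
    where u = ln (1⁺ /⁺ 1-value⁺ lam)

  -- The entropy times `Q` is `l (Q - A) + (1 - l) (Q - B)`, that is `Q - KL`.
  1-H≈KL/lnq : 1ℝ - H 1/[1- p ] lam ≈ KL lam p / Q⁺
  1-H≈KL/lnq = begin-equality
    1ℝ - H 1/[1- p ] lam
      ≈⟨ +-cong (≈-sym (recip-*ˡ Q (positive Q⁺))) (-‿cong (+-cong
           (*-congˡ l (*-congʳ r ln[q-1]/l))
           (*-congˡ (1ℝ - l) (*-congʳ r ln1/[1-l])))) ⟩
    r * Q - (l * ((Q - A) * r) + (1ℝ - l) * ((Q - B) * r))
      ≈⟨ solve 5 (λ l A B Q r → r :* Q :- (l :* ((Q :- A) :* r) :+ (con 1ℚ :- l) :* ((Q :- B) :* r)) := (l :* A :+ (con 1ℚ :- l) :* B) :* r)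
           ≈-refl l A B Q r ⟩
    KL lam p / Q⁺ ∎
    where r = recip Q (positive Q⁺)

  1-H-positive : l < π ⊎ π < l → 0ℝ < 1ℝ - H 1/[1- p ] lam
  1-H-positive l≢π = <-≤-trans (*-positive (KL-positive l≢π) (recip-positive (positive Q⁺))) (≈⇒≤ (≈-sym 1-H≈KL/lnq))

  -- Multiplied by `1 - H`, which is `KL / ln q`, both quotients become the logarithm of `x` to base
  -- `q`.
  ln/KL≈log/[1-H] : ∀ x (0<KL : 0ℝ < KL lam p) (0<1-H : 0ℝ < 1ℝ - H 1/[1- p ] lam) →
    ln x / (KL lam p ,⁺ 0<KL) ≈ log 1/[1- p ] x / (1ℝ - H 1/[1- p ] lam ,⁺ 0<1-H)
  ln/KL≈log/[1-H] x 0<KL 0<1-H = *-cancelʳ-≈ 0<1-H (begin-equality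
    ln x / K * (1ℝ - H 1/[1- p ] lam)   ≈⟨ *-congˡ (ln x / K) 1-H≈KL/lnq ⟩
    ln x / K * (KL lam p * r)           ≈⟨ solve 3 (λ x k r → x :* (k :* r) := x :* k :* r) ≈-refl (ln x / K) (KL lam p) r ⟩
    ln x / K * KL lam p * r             ≈⟨ *-congʳ r (/-* (ln x) K) ⟩
    log 1/[1- p ] x                     ≈⟨ /-* (log 1/[1- p ] x) (1ℝ - H 1/[1- p ] lam ,⁺ 0<1-H) ⟨
    log 1/[1- p ] x / (1ℝ - H 1/[1- p ] lam ,⁺ 0<1-H) * (1ℝ - H 1/[1- p ] lam) ∎)
    where
    K = KL lam p ,⁺ 0<KL
    r = recip Q (positive Q⁺)

-- Each of the `n` terms is at most `exp (- ln n)`, that is `1 / n`.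
∑exp-neg-ln≤1 : ∀ {n} .{{_ : ℕ.NonZero n}} (x : Vector ℝ n) → (∀ i → ln (fromℕ⁺ n) ≤ x i) → ∑ (λ i → exp (- x i)) ≤ 1ℝ
∑exp-neg-ln≤1 {n} x lnn≤x = begin
  ∑ (λ i → exp (- x i))             ≤⟨ ∑-mono-≤ (λ i → exp-mono-≤ (≤-by { - x i} (x i - L) (diff≥0 (lnn≤x i))
                                         (solve 2 (λ x L → :- x :+ (x :- L) := :- L) ≈-refl (x i) L))) ⟩
  ∑ {n} (λ _ → exp (- L))           ≈⟨ ∑-const n (exp (- L)) ⟩
  fromℕ n * exp (- L)               ≈⟨ *-comm (fromℕ n) (exp (- L)) ⟩
  exp (- L) * fromℕ n               ≈⟨ *-congˡ (exp (- L)) (exp-ln (fromℕ⁺ n)) ⟨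
  exp (- L) * exp L                 ≈⟨ exp-neg-* L ⟩
  1ℝ                                ∎
  where L = ln (fromℕ⁺ n)

-- The sample meeting all the bounds.

module _ {ℓ} (𝒮 : FiniteProbabilitySpace ℓ) {N : ℕ} (X : Fin N → Ω 𝒮 → Fin 2) (N′ : ℕ) (lam p : Fin N → 𝕀)
  (lower : ∀ i → toℕ i ℕ.< N′ → value (lam i) < value (p i) × value (p i) ≤ 𝔼 𝒮 (λ s → bit (X i s)))
  (upper : ∀ j → N′ ℕ.≤ toℕ j → value (p j) < value (lam j) × 𝔼 𝒮 (λ s → bit (X j s)) ≤ value (p j)) where

  module LR i = LikelihoodRatio (lam i) (p i)

  -- The comparison is made between natural numbers, where it is decidable; the hypotheses then
  -- supply the order of the two reals.
  lam≢p : ∀ i → value (lam i) < value (p i) ⊎ value (p i) < value (lam i)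
  lam≢p i = [ (λ i<N′ → inj₁ (proj₁ (lower i i<N′))) , (λ N′≤i → inj₂ (proj₁ (upper i N′≤i))) ]′ (ℕ.<-≤-connex (toℕ i) N′)

  0<KL : ∀ i → 0ℝ < KL (lam i) (p i)
  0<KL i = LR.KL-positive i (lam≢p i)

  score : Fin N → Ω 𝒮 → ℝ
  score i s = LR.score i (X i s)

  𝔼-exp-score≤1 : ∀ i → 𝔼 𝒮 (λ s → exp (score i s)) ≤ 1ℝ
  𝔼-exp-score≤1 i = begin
    𝔼 𝒮 (λ s → exp (score i s))
      ≈⟨ ∑-cong (λ k → *-congˡ (weight (outcome k)) (exp-score (X i (outcome k)))) ⟩
    𝔼 𝒮 (λ s → bit (X i s) * (exp A - exp B) + exp B)
      ≈⟨ 𝔼-affine 𝒮 (λ s → bit (X i s)) (exp A - exp B) (exp B) ⟩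
    μ * (exp A - exp B) + exp B
      ≤⟨ expected-ratio≤1 μ side ⟩
    1ℝ ∎
    where
    open FiniteProbabilitySpace 𝒮 using (weight; outcome)
    open LikelihoodRatio (lam i) (p i) hiding (score)
    μ = 𝔼 𝒮 (λ s → bit (X i s))
    side : (exp A < exp B × value (p i) ≤ μ) ⊎ (exp B < exp A × μ ≤ value (p i))
    side = [ (λ i<N′ → let h = lower i i<N′ in inj₁ (exp-mono-< (lower-A<B (proj₁ h)) , proj₂ h))
           , (λ N′≤i → let h = upper i N′≤i in inj₂ (exp-mono-< (upper-B<A (proj₁ h)) , proj₂ h)) ]′ (ℕ.<-≤-connex (toℕ i) N′)

  chernoff-sample : ∀ m .{{_ : ℕ.NonZero m}} → ∑ (λ i → exp (- (KL (lam i) (p i) * fromℕ m))) ≤ 1ℝ → GoodSample X N′ lam m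
  chernoff-sample m P₀≤1 = S ,
    (λ i i<N′ → ≤-/ {value (lam i)} (fromℕ⁺ m) (LR.lower-tail i m (λ k → X i (S k)) (z<1 i) (proj₁ (lower i i<N′)))) ,
    (λ j N′≤j → /-≤ {value (lam j)} (fromℕ⁺ m) (LR.upper-tail j m (λ k → X j (S k)) (z<1 j) (proj₁ (upper j N′≤j))))
    where
    -- `x` holds the exponents before any draw; `e` bounds the exponents after `m` draws from below,
    -- whatever the sample.
    x e : Vector ℝ N
    x i = - (KL (lam i) (p i) * fromℕ m)
    e i = x i + fromℕ m * LR.minScore i
    0<m : 0ℝ < fromℕ m
    0<m = positive (fromℕ⁺ m)
    -- Strictness comes from `KL` being positive; it is what `threshold` relies on when there is
    -- only one variable.
    exp-x<1 : ∀ i → exp (x i) < 1ℝ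
    exp-x<1 i = <-≤-trans (exp-mono-< (neg<0 (*-positive (0<KL i) 0<m))) (≈⇒≤ exp-0)
    T = threshold (λ i → exp (x i)) e exp-x<1 P₀≤1
    drawn = sample 𝒮 score 𝔼-exp-score≤1 m x (proj₁ (proj₂ T))
    S = proj₁ drawn
    z<1 : ∀ i → exp (x i + ∑ (λ k → score i (S k))) < 1ℝ
    z<1 = proj₂ (proj₂ T) (λ i → exp (x i + ∑ (λ k → score i (S k))))
      (λ i → exp-mono-≤ (+-mono-≤ (≤-refl {x i}) (LR.m*minScore≤ i m (λ k → X i (S k)))))
      (proj₂ drawn)

theorem1 : ∀ {ℓ} (𝒮 : FiniteProbabilitySpace ℓ) {N : ℕ} (X : Fin N → Ω 𝒮 → Fin 2) →
    (N′ : ℕ) → N′ ℕ.≤ N → (lam p : Fin N → 𝕀) →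
    (∀ i → toℕ i ℕ.< N′ → value (lam i) < value (p i) × value (p i) ≤ 𝔼 𝒮 (λ s → bit (X i s))) →
    (∀ j → N′ ℕ.≤ toℕ j → value (p j) < value (lam j) × 𝔼 𝒮 (λ s → bit (X j s)) ≤ value (p j)) →
    (∀ m .{{_ : ℕ.NonZero m}} → ∑ (λ i → exp (- (KL (lam i) (p i) * fromℕ m))) ≤ 1ℝ → GoodSample X N′ lam m)
    ×
    (.{{_ : ℕ.NonZero N}} →
    Σ (∀ i → 0ℝ < KL (lam i) (p i)) λ 0<KL →
    Σ (∀ i → 0ℝ < 1ℝ - H 1/[1- p i ] (lam i)) λ 0<1-H →
    maximum (λ i → ln (fromℕ⁺ N) / (KL (lam i) (p i) ,⁺ 0<KL i))
    ≈ maximum (λ i → log 1/[1- p i ] (fromℕ⁺ N) / (1ℝ - H 1/[1- p i ] (lam i) ,⁺ 0<1-H i))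
    ×
    (∀ m .{{_ : ℕ.NonZero m}} →
    maximum (λ i → ln (fromℕ⁺ N) / (KL (lam i) (p i) ,⁺ 0<KL i)) ≤ fromℕ m → GoodSample X N′ lam m))
theorem1 𝒮 {N} X N′ _ lam p lower upper = chernoff-sample 𝒮 X N′ lam p lower upper ,
  (KL>0 , 1-H>0 ,
    maximum-cong (λ i → LikelihoodRatio.ln/KL≈log/[1-H] (lam i) (p i) (fromℕ⁺ N) (KL>0 i) (1-H>0 i)) ,
    λ m max≤m → chernoff-sample 𝒮 X N′ lam p lower upper m
      -- Clearing the positive denominator from the bound on the maximum gives `ln N` at most
      -- `KL * m` for every index, so the exponential sum is at most 1.
      (∑exp-neg-ln≤1 (λ i → KL (lam i) (p i) * fromℕ m) (λ i → begin
        ln (fromℕ⁺ N)                            ≈⟨ /-* (ln (fromℕ⁺ N)) (K i) ⟨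
        ln (fromℕ⁺ N) / K i * KL (lam i) (p i)   ≤⟨ *-monoʳ-≤ (KL>0 i) (≤-trans (term≤maximum (λ i → ln (fromℕ⁺ N) / K i) i) max≤m) ⟩
        fromℕ m * KL (lam i) (p i)               ≈⟨ *-comm (fromℕ m) (KL (lam i) (p i)) ⟩
        KL (lam i) (p i) * fromℕ m               ∎)))
  where
  KL>0 : ∀ i → 0ℝ < KL (lam i) (p i)
  KL>0 = 0<KL 𝒮 X N′ lam p lower upper
  K : Fin N → ℝ⁺
  K i = KL (lam i) (p i) ,⁺ KL>0 i
  1-H>0 : ∀ i → 0ℝ < 1ℝ - H 1/[1- p i ] (lam i)
  1-H>0 i = LikelihoodRatio.1-H-positive (lam i) (p i) (lam≢p 𝒮 X N′ lam p lower upper i)
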